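{- Let $s\in\mathbb{N}$, let $\Lambda$ be an $s$-dimensional index set, let $\mathcal{F}=\{\xi_{\mathbf k}:\mathbf k\in\Lambda\}$ be a uniform distribution determining (u.d.d.) function system on $[0,1)^s$, and let $\rho$ be a weight function on $\Lambda$. Let $\omega=(\mathbf x_n)_{n\ge 0}$ be a sequence in $[0,1)^s$, and for $N\in\mathbb{N}$ let $\sigma_N(\omega)$ be the spectral test of the first $N$ elements of $\omega$ with respect to $\mathcal{F}$ and $\rho$. Then: (1) For every $N\in\mathbb{N}$ the quantity $\sigma_N(\omega)$ is a maximum, i.e. the supremum $\sup_{\mathbf k\in\Lambda^*}\rho(\mathbf k)\,|S_N(\xi_{\mathbf k},\omega)|$ occurring in its definition is attained at some $\mathbf k\in\Lambda^*$. (2) The sequence $\omega$ is uniformly distributed in $[0,1)^s$ (uniformly distributed modulo one) if and only if $\lim_{N\to\infty}\sigma_N(\omega)=0$.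
   Context: $\mathbb{N}$ denotes the positive integers, $\mathbb{N}_0=\mathbb{N}\cup\{0\}$, and $\lambda_s$ is Lebesgue (Haar) measure on $[0,1)^s$. An $s$-dimensional index set $\Lambda$ is one of the additive semigroups $\mathbb{Z}^s$, $\mathbb{N}_0^s$, $\mathbb{N}^s$, or a finite direct product of such semigroups whose dimensions add up to $s$. Put $\Lambda^*=\Lambda\setminus\{\mathbf 0\}$. For $f:[0,1)^s\to\mathbb{C}$ and a sequence $\omega=(\mathbf x_n)_{n\ge0}$ in $[0,1)^s$, $S_N(f,\omega)=\frac1N\sum_{n=0}^{N-1}f(\mathbf x_n)$. A sequence $\omega$ is uniformly distributed in $[0,1)^s$ if $\lim_{N\to\infty}S_N(\mathbf 1_J-\lambda_s(J),\omega)=0$ for every interval $J=\prod_{i=1}^s[u_i,v_i)$ with $0\le u_i<v_i\le1$. A family $\mathcal{F}=\{\xi_{\mathbf k}:\mathbf k\in\Lambda\}$ of (complex-valued) Riemann integrable functions on $[0,1)^s$ is a u.d.d. function system if: $\sup_{\mathbf x\in[0,1)^s}|\xi_{\mathbf k}(\mathbf x)|\le1$ for all $\mathbf k\in\Lambda$; $\int_{[0,1)^s}\xi_{\mathbf k}\,d\lambda_s=0$ for all $\mathbf k\in\Lambda^*$; and for any sequence $\omega$ in $[0,1)^s$, the property that $\lim_{N\to\infty}S_N(\xi_{\mathbf k},\omega)=0$ for all $\mathbf k\in\Lambda^*$ implies that $\omega$ is uniformly distributed in $[0,1)^s$. Let $\|\cdot\|$ be an arbitrary norm on $\mathbb{R}^s$.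 A weight function on $\Lambda$ is a function $\rho:\Lambda\to\mathbb{R}$ with $\rho(\mathbf k)>0$ for all $\mathbf k\in\Lambda$, such that for every $\epsilon>0$ there is a positive real $K_0$ with $\rho(\mathbf k)<\epsilon$ for all $\mathbf k\in\Lambda$ with $\|\mathbf k\|>K_0$. The spectral test of the first $N$ elements of $\omega$ with respect to $\mathcal{F}$ and $\rho$ is $$\sigma_N(\omega)=\Big(\sup_{\mathbf k\in\Lambda^*}\rho(\mathbf k)\Big)^{ -1}\sup_{\mathbf k\in\Lambda^*}\big\{\rho(\mathbf k)\,|S_N(\xi_{\mathbf k},\omega)|\big\}.$$ -}

module Defs where

open import Algebra.Bundles using (CommutativeRing)
import Algebra.Construct.NaturalChoice.Max as Max
import Algebra.Definitions.RawMonoid as RawMonoidDefs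
open import Axiom.ExcludedMiddle using (ExcludedMiddle)
open import Data.Fin.Base using (Fin; toℕ)
open import Data.Integer.Base using (ℤ; +_; -[1+_]; 0ℤ)
open import Data.List.Base using (List; foldr)
open import Data.Nat.Base as ℕ using (ℕ; suc; NonZero)
open import Data.Product.Base using (Σ; ∃; ∃-syntax; _×_; _,_; proj₁; proj₂)
open import Data.Product.Relation.Binary.Pointwise.NonDependent using (×-setoid)
open import Data.Vec.Base using (Vec; lookup)
open import Data.Vec.Functional as Vector using (Vector)
import Data.Vec.Functional.Relation.Binary.Equality.Setoid as VecEq
open import Function.Bundles using (Func)
open import Level using (0ℓ) renaming (suc to lsuc)
open import Relation.Binary.Bundles using (Setoid; TotalOrder)
open import Relation.Binary.Core using (Rel)
import Relation.Binary.Construct.NonStrictToStrict as ToStrict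
import Relation.Binary.Construct.On as On
open import Relation.Binary.PropositionalEquality.Core using (_≡_)
open import Relation.Binary.Structures using (IsTotalOrder)
open import Relation.Nullary.Decidable.Core using (Dec; yes; no)
open import Relation.Nullary.Negation.Core using (¬_)
open import Relation.Unary using (Pred; Satisfiable)

-- The real numbers, axiomatised as a Dedekind-complete ordered field; all
-- models are isomorphic.  The equality is a setoid equality, so that (given
-- excluded middle) a model can be built from Dedekind cuts or Cauchy sequences.
record CompleteOrderedField : Set₁ where
  infix 4 _≤_
  infix 8 _⁻¹

  field
    commutativeRing : CommutativeRing 0ℓ 0ℓ

  open CommutativeRing commutativeRing public renaming (Carrier to ℝ)

  field
    _≤_          : Rel ℝ 0ℓ
    isTotalOrder : IsTotalOrder _≈_ _≤_
    +-monoˡ-≤    : ∀ z {x y} → x ≤ y → x + z ≤ y + z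
    *-nonNeg     : ∀ {x y} → 0# ≤ x → 0# ≤ y → 0# ≤ x * y
    0≉1          : 0# ≉ 1#
    -- Total; the value at 0# is unspecified.
    _⁻¹          : ℝ → ℝ
    ⁻¹-cong      : ∀ {x y} → x ≈ y → x ⁻¹ ≈ y ⁻¹
    ⁻¹-inverseʳ  : ∀ {x} → x ≉ 0# → x * x ⁻¹ ≈ 1#

  IsUpperBound : Pred ℝ 0ℓ → Pred ℝ 0ℓ
  IsUpperBound P b = ∀ x → P x → x ≤ b

  IsLowerBound : Pred ℝ 0ℓ → Pred ℝ 0ℓ
  IsLowerBound P b = ∀ x → P x → b ≤ x

  IsSupremum : Pred ℝ 0ℓ → Pred ℝ 0ℓ
  IsSupremum P v = IsUpperBound P v × (∀ b → IsUpperBound P b → v ≤ b)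

  IsInfimum : Pred ℝ 0ℓ → Pred ℝ 0ℓ
  IsInfimum P v = IsLowerBound P v × (∀ b → IsLowerBound P b → b ≤ v)

  field
    complete : (P : Pred ℝ 0ℓ) → Satisfiable P → Satisfiable (IsUpperBound P) →
               ∃ (IsSupremum P)

  totalOrder : TotalOrder 0ℓ 0ℓ 0ℓ
  totalOrder = record { isTotalOrder = isTotalOrder }

  open ToStrict _≈_ _≤_ public using (_<_)
  open Max totalOrder public using (_⊔_)

  ∣_∣ : ℝ → ℝ
  ∣ x ∣ = x ⊔ - x

  open RawMonoidDefs +-rawMonoid public using (sum) renaming (_×_ to _·_)
  open RawMonoidDefs *-rawMonoid public using () renaming (sum to product)

  fromℕ : ℕ → ℝ
  fromℕ n = n · 1#

  fromℤ : ℤ → ℝ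
  fromℤ (+ n)    = fromℕ n
  fromℤ -[1+ n ] = - fromℕ (suc n)

infixr 5 _⊗_

data IndexSet : ℕ → Set where
  ℤ^_  : ∀ s → IndexSet s
  ℕ₀^_ : ∀ s → IndexSet s
  ℕ^_  : ∀ s → IndexSet s
  _⊗_  : ∀ {s t} → IndexSet s → IndexSet t → IndexSet (s ℕ.+ t)

⟦_⟧ : ∀ {s} → IndexSet s → Set
⟦ ℤ^ s ⟧  = Vec ℤ s
⟦ ℕ₀^ s ⟧ = Vec ℕ s
⟦ ℕ^ s ⟧  = Vec (∃ NonZero) s
⟦ Λ ⊗ Μ ⟧ = ⟦ Λ ⟧ × ⟦ Μ ⟧

coords : ∀ {s} (Λ : IndexSet s) → ⟦ Λ ⟧ → Vector ℤ s
coords (ℤ^ s)  k       = lookup k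
coords (ℕ₀^ s) k       = λ i → + lookup k i
coords (ℕ^ s)  k       = λ i → + proj₁ (lookup k i)
coords (Λ ⊗ Μ) (k , l) = coords Λ k Vector.++ coords Μ l

_∖𝟎 : ∀ {s} → IndexSet s → Set
Λ ∖𝟎 = Σ ⟦ Λ ⟧ λ k → ¬ (∀ i → coords Λ k i ≡ 0ℤ)

module Analysis (em : ExcludedMiddle 0ℓ) (R : CompleteOrderedField) where

  open CompleteOrderedField R

  -- The supremum of a nonempty set that is bounded above; 0# otherwise.
  sup : Pred ℝ 0ℓ → ℝ
  sup P with em {Satisfiable P × Satisfiable (IsUpperBound P)}
  ... | yes (nonempty , bounded) = proj₁ (complete P nonempty bounded)
  ... | no _                     = 0#

  Range : {I : Set} → (I → ℝ) → Pred ℝ 0ℓ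
  Range f y = ∃[ i ] y ≈ f i

  ⨆ : {I : Set} → (I → ℝ) → ℝ
  ⨆ f = sup (Range f)

  -- The first component excludes the default value of sup.
  SupremumAttained : {I : Set} → (I → ℝ) → Set
  SupremumAttained f = IsSupremum (Range f) (⨆ f) × (∃[ i ] ⨆ f ≈ f i)

  √_ : ℝ → ℝ
  √ x = sup λ t → t * t ≤ x

  infix 4 _⟶_
  _⟶_ : (ℕ → ℝ) → ℝ → Set
  a ⟶ l = ∀ ε → 0# < ε → ∃[ N₀ ] (∀ N → N₀ ℕ.≤ N → ∣ a N - l ∣ < ε)

  ℂ-setoid : Setoid 0ℓ 0ℓ
  ℂ-setoid = ×-setoid setoid setoid

  ℂ : Set
  ℂ = Setoid.Carrier ℂ-setoid

  re im : ℂ → ℝ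
  re = proj₁
  im = proj₂

  0ℂ : ℂ
  0ℂ = 0# , 0#

  _-ℂ_ : ℂ → ℂ → ℂ
  (a , b) -ℂ (c , d) = a - c , b - d

  ∣_∣ℂ : ℂ → ℝ
  ∣ a , b ∣ℂ = √ (a * a + b * b)

  infix 4 _⟶ℂ_
  _⟶ℂ_ : (ℕ → ℂ) → ℂ → Set
  a ⟶ℂ l = ∀ ε → 0# < ε → ∃[ N₀ ] (∀ N → N₀ ℕ.≤ N → ∣ a N -ℂ l ∣ℂ < ε)

  record IsNorm {s} (‖_‖ : Vector ℝ s → ℝ) : Set where
    open VecEq setoid using (_≋_)
    field
      ‖‖-cong     : ∀ {x y} → x ≋ y → ‖ x ‖ ≈ ‖ y ‖
      nonNegative : ∀ x → 0# ≤ ‖ x ‖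
      definite    : ∀ x → ‖ x ‖ ≈ 0# → ∀ i → x i ≈ 0#
      homogeneous : ∀ a x → ‖ (λ i → a * x i) ‖ ≈ ∣ a ∣ * ‖ x ‖
      triangle    : ∀ x y → ‖ (λ i → x i + y i) ‖ ≤ ‖ x ‖ + ‖ y ‖

  -- The half-open unit cube [0,1)^s.
  Cube-setoid : ℕ → Setoid 0ℓ 0ℓ
  Cube-setoid s = On.setoid {B = Σ (Vector ℝ s) λ x → ∀ i → 0# ≤ x i × x i < 1#}
                            (VecEq.≋-setoid setoid s) proj₁

  Cube : ℕ → Set
  Cube s = Setoid.Carrier (Cube-setoid s)

  record Box (s : ℕ) : Set where
    field
      lo hi : Vector ℝ s
      0≤lo  : ∀ i → 0# ≤ lo i
      lo<hi : ∀ i → lo i < hi i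
      hi≤1  : ∀ i → hi i ≤ 1#

  module _ {s : ℕ} where

    _∈ᵇ_ : Cube s → Box s → Set
    (x , _) ∈ᵇ J = ∀ i → Box.lo J i ≤ x i × x i < Box.hi J i

    volume : Box s → ℝ
    volume J = product λ i → Box.hi J i - Box.lo J i

    𝟙 : Box s → Cube s → ℝ
    𝟙 J x with em {x ∈ᵇ J}
    ... | yes _ = 1#
    ... | no  _ = 0#

    -- Step functions, represented as finite linear combinations Σ cⱼ 𝟙_{Jⱼ}
    -- of indicators of (possibly overlapping) half-open boxes.  The elementary
    -- integral Σ cⱼ λ(Jⱼ) depends only on the function represented.
    Step : Set
    Step = List (ℝ × Box s)

    eval : Step → Cube s → ℝ
    eval φ x = foldr (λ (c , J) acc → c * 𝟙 J x + acc) 0# φ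

    integralˢ : Step → ℝ
    integralˢ = foldr (λ (c , J) acc → c * volume J + acc) 0#

    LowerIntegrals UpperIntegrals : (Cube s → ℝ) → Pred ℝ 0ℓ
    LowerIntegrals f y = ∃[ φ ] ((∀ x → eval φ x ≤ f x) × y ≈ integralˢ φ)
    UpperIntegrals f y = ∃[ ψ ] ((∀ x → f x ≤ eval ψ x) × y ≈ integralˢ ψ)

    -- f is Riemann integrable with integral v: its lower and upper Darboux
    -- integrals exist in ℝ and both equal v.  Boundedness of f is implied, as an
    -- empty set of reals has neither a supremum nor an infimum.  For a Riemann
    -- integrable f this v is also the Lebesgue integral.
    HasIntegralℝ : (Cube s → ℝ) → ℝ → Set
    HasIntegralℝ f v = IsSupremum (LowerIntegrals f) v × IsInfimum (UpperIntegrals f) v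

    HasIntegral : (Cube s → ℂ) → ℂ → Set
    HasIntegral f v = HasIntegralℝ (λ x → re (f x)) (re v) ×
                      HasIntegralℝ (λ x → im (f x)) (im v)

    RiemannIntegrable : (Cube s → ℂ) → Set
    RiemannIntegrable f = ∃ (HasIntegral f)

    -- The averages are meaningful for N ≥ 1 only.
    Sℝ : ℕ → (Cube s → ℝ) → (ℕ → Cube s) → ℝ
    Sℝ N f ω = fromℕ N ⁻¹ * sum {N} λ n → f (ω (toℕ n))

    S : ℕ → (Cube s → ℂ) → (ℕ → Cube s) → ℂ
    S N f ω = Sℝ N (λ x → re (f x)) ω , Sℝ N (λ x → im (f x)) ω

    UniformlyDistributed : (ℕ → Cube s) → Set
    UniformlyDistributed ω =
      ∀ (J : Box s) → (λ N → Sℝ N (λ x → 𝟙 J x - volume J) ω) ⟶ 0#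

  -- Functions [0,1)^s → ℂ, respecting the setoid equalities.
  CubeFunction : ℕ → Set
  CubeFunction s = Func (Cube-setoid s) ℂ-setoid

  module _ {s : ℕ} (Λ : IndexSet s) where

    record IsUDD (ξ : ⟦ Λ ⟧ → CubeFunction s) : Set where
      field
        riemann     : ∀ k → RiemannIntegrable (Func.to (ξ k))
        bounded     : ∀ k x → ∣ Func.to (ξ k) x ∣ℂ ≤ 1#
        meanZero    : ∀ ((k , _) : Λ ∖𝟎) → HasIntegral (Func.to (ξ k)) 0ℂ
        determining : ∀ (ω : ℕ → Cube s) →
                      (∀ ((k , _) : Λ ∖𝟎) → (λ N → S N (Func.to (ξ k)) ω) ⟶ℂ 0ℂ) →
                      UniformlyDistributed ω

    record IsWeight (‖_‖ : Vector ℝ s → ℝ) (ρ : ⟦ Λ ⟧ → ℝ) : Set where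
      field
        positive  : ∀ k → 0# < ρ k
        vanishing : ∀ ε → 0# < ε → ∃[ K₀ ] (0# < K₀ ×
                    (∀ k → K₀ < ‖ (λ i → fromℤ (coords Λ k i)) ‖ → ρ k < ε))

    module _ (ξ : ⟦ Λ ⟧ → CubeFunction s) (ρ : ⟦ Λ ⟧ → ℝ) (ω : ℕ → Cube s) where

      weightedAverage : ℕ → Λ ∖𝟎 → ℝ
      weightedAverage N (k , _) = ρ k * ∣ S N (Func.to (ξ k)) ω ∣ℂ

      spectralTest : ℕ → ℝ
      spectralTest N =
        (⨆ λ ((k , _) : Λ ∖𝟎) → ρ k) ⁻¹ * ⨆ (weightedAverage N)

{-# OPTIONS --safe #-}
module Submission where

-- Estimating the modulus by real and imaginary part gives |S_N(ξ_k)| ≤ 2, which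
-- serves as well as the sharp bound 1: ρ(k)|S_N(ξ_k)| ≤ 2ρ(k) uniformly in N.
-- All norms on ℝˢ being equivalent, only finitely many k have ρ(k) ≥ ε; hence a
-- supremum of values ρ(k)|S_N(ξ_k)| is a maximum over finitely many k, and it
-- tends to 0 as soon as each S_N(ξ_k) does.  For a uniformly distributed
-- sequence this holds because averages of step functions converge to their
-- integrals and ξ_k is squeezed between step functions.  Conversely σ_N
-- dominates each ρ(k)|S_N(ξ_k)| up to the factor sup ρ, and the system is
-- determining.

open import Defs
open import Algebra.Bundles using (CommutativeRing)
import Algebra.Construct.NaturalChoice.Max as NaturalMax
import Algebra.Properties.AbelianGroup
import Algebra.Properties.CommutativeSemigroup
import Algebra.Properties.Group
import Algebra.Properties.Ring
import Algebra.Properties.Semiring.Mult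
import Algebra.Properties.Semiring.Mult.TCOptimised
import Algebra.Properties.Semiring.Sum
import Algebra.Solver.Ring
open import Algebra.Solver.Ring.AlmostCommutativeRing
  using (fromCommutativeRing; _-Raw-AlmostCommutative⟶_)
open import Axiom.ExcludedMiddle using (ExcludedMiddle)
open import Data.Fin.Base using (Fin; zero; suc; toℕ; splitAt; _↑ˡ_; _↑ʳ_)
open import Data.Integer.Base as ℤ using (ℤ; +_; -[1+_]; 0ℤ)
import Data.Integer.Properties as ℤ
open import Data.List.Base as List using (List; []; _∷_)
open import Data.List.Membership.Propositional using (_∈_)
open import Data.List.Membership.Propositional.Properties
  using (∈-map⁺; ∈-++⁺ˡ; ∈-++⁺ʳ; ∈-upTo⁺; ∈-cartesianProduct⁺; ∈-cartesianProductWith⁺)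
open import Data.List.Relation.Unary.Any using (here; there)
open import Data.Maybe.Base using (map)
open import Data.Nat.Base as ℕ using (ℕ; zero; suc; NonZero)
import Data.Nat.Properties as ℕ
open import Data.Product.Base using (Σ; ∃-syntax; _×_; _,_; proj₁; proj₂)
open import Data.Sum.Base using (inj₁; inj₂)
open import Data.Vec.Base as Vec using (Vec; []; _∷_; lookup)
open import Data.Vec.Functional as Vector using (Vector; tail)
open import Data.Vec.Functional.Properties using (lookup-++ˡ; lookup-++ʳ)
open import Data.Vec.Properties using (lookup-replicate)
open import Function.Base using (_∘_)
open import Function.Bundles using (Func; _⇔_; mk⇔)
open import Level using (0ℓ)
open import Relation.Binary.Bundles using (TotalOrder)
import Relation.Binary.Construct.NonStrictToStrict as ToStrict
open import Relation.Binary.PropositionalEquality.Core as ≡ using (_≡_; _≢_)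
import Relation.Binary.Reasoning.PartialOrder as PartialOrderReasoning
import Relation.Binary.Reasoning.Setoid
open import Relation.Nullary.Decidable.Core using (yes; no; dec⇒maybe)
open import Relation.Nullary.Negation.Core using (¬_; contradiction)
open import Relation.Unary using (Pred; Satisfiable)

-- The equivalence of norms has to come from least upper bounds of sets of reals. Induction on the
-- dimension reduces it to one question: the hyperplane `x zero = 0` carries a norm already
-- understood, and what remains is how near the slice `x zero = 1` can come to the origin. The
-- direction that yields finiteness is `∣ x i ∣ ≤ C * ‖ x ‖`; the opposite bound enters the limit
-- argument for the slice. Finiteness concerns thresholds `ε > 0`, so the case in which every
-- average vanishes is separate: there any index attains the supremum. That some index exists comes
-- from `s ≥ 1`. At `N = 0` the factor `fromℕ N ⁻¹` has no specified value, so the estimates carry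
-- `NonZero N` and the limits discard `N = 0`.

-- The library's solver for commutative rings takes coefficients from the ring
-- itself and cannot recognise that they cancel; integer coefficients can.
module IntegerCoefficients (C : CommutativeRing 0ℓ 0ℓ) where
  open CommutativeRing C
  open Algebra.Properties.AbelianGroup +-abelianGroup using (⁻¹-∙-comm)
  open Algebra.Properties.Group +-group using (⁻¹-involutive; ε⁻¹≈ε)
  open Algebra.Properties.Ring ring using (-‿distribˡ-*; -‿distribʳ-*)
  open Algebra.Properties.Semiring.Mult.TCOptimised semiring
    using (×-homo-+; ×1-homo-*) renaming (_×_ to _·_)
  open Algebra.Properties.CommutativeSemigroup +-commutativeSemigroup
    using (interchange)
  open Relation.Binary.Reasoning.Setoid setoid

  fromInt : ℤ → Carrier
  fromInt (+ n)    = n · 1#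
  fromInt -[1+ n ] = - (suc n · 1#)

  -‿homo : ∀ i → fromInt (ℤ.- i) ≈ - fromInt i
  -‿homo (+ zero)  = sym ε⁻¹≈ε
  -‿homo (+ suc _) = refl
  -‿homo -[1+ _ ]  = sym (⁻¹-involutive _)

  ⊖-homo : ∀ m n → fromInt (m ℤ.⊖ n) ≈ m · 1# - n · 1#
  ⊖-homo m zero = begin
    fromInt (m ℤ.⊖ 0)  ≡⟨ ≡.cong fromInt (ℤ.⊖-≥ {m} ℕ.z≤n) ⟩
    m · 1#             ≈⟨ +-identityʳ _ ⟨
    m · 1# + 0#        ≈⟨ +-congˡ ε⁻¹≈ε ⟨
    m · 1# - 0#        ∎
  ⊖-homo zero (suc n) = sym (+-identityˡ _)
  ⊖-homo (suc m) (suc n) = begin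
    fromInt (suc m ℤ.⊖ suc n)        ≡⟨ ≡.cong fromInt (ℤ.[1+m]⊖[1+n]≡m⊖n m n) ⟩
    fromInt (m ℤ.⊖ n)                ≈⟨ ⊖-homo m n ⟩
    m · 1# - n · 1#                  ≈⟨ +-identityˡ _ ⟨
    0# + (m · 1# - n · 1#)           ≈⟨ +-congʳ (-‿inverseʳ 1#) ⟨
    (1# - 1#) + (m · 1# - n · 1#)    ≈⟨ interchange 1# (- 1#) _ _ ⟩
    (1# + m · 1#) + (- 1# - n · 1#)  ≈⟨ +-congˡ (⁻¹-∙-comm 1# (n · 1#)) ⟩
    (1# + m · 1#) - (1# + n · 1#)    ≈⟨ +-cong (×-homo-+ 1# 1 m) (-‿cong (×-homo-+ 1# 1 n)) ⟨
    suc m · 1# - suc n · 1#          ∎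

  +-homo : ∀ i j → fromInt (i ℤ.+ j) ≈ fromInt i + fromInt j
  +-homo (+ m)    (+ n)    = ×-homo-+ 1# m n
  +-homo (+ m)    -[1+ n ] = ⊖-homo m (suc n)
  +-homo -[1+ m ] (+ n)    = trans (⊖-homo n (suc m)) (+-comm _ _)
  +-homo -[1+ m ] -[1+ n ] = begin
    - (suc (suc (m ℕ.+ n)) · 1#)       ≡⟨ ≡.cong (λ k → - (k · 1#)) (≡.sym (ℕ.+-suc (suc m) n)) ⟩
    - ((suc m ℕ.+ suc n) · 1#)         ≈⟨ -‿cong (×-homo-+ 1# (suc m) (suc n)) ⟩
    - (suc m · 1# + suc n · 1#)        ≈⟨ ⁻¹-∙-comm _ _ ⟨
    - (suc m · 1#) - (suc n · 1#)      ∎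

  *-homo : ∀ i j → fromInt (i ℤ.* j) ≈ fromInt i * fromInt j
  *-homo (+ m)    (+ n)    = trans (reflexive (≡.cong fromInt (ℤ.+◃n≡+n (m ℕ.* n)))) (×1-homo-* m n)
  *-homo (+ m)    -[1+ n ] = begin
    fromInt (+ m ℤ.* -[1+ n ])       ≡⟨ ≡.cong fromInt (ℤ.-◃n≡-n (m ℕ.* suc n)) ⟩
    fromInt (ℤ.- + (m ℕ.* suc n))    ≈⟨ -‿homo (+ (m ℕ.* suc n)) ⟩
    - ((m ℕ.* suc n) · 1#)           ≈⟨ -‿cong (×1-homo-* m (suc n)) ⟩
    - (m · 1# * suc n · 1#)          ≈⟨ -‿distribʳ-* _ _ ⟩
    m · 1# * - (suc n · 1#)          ∎
  *-homo -[1+ m ] (+ n)    = begin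
    fromInt (-[1+ m ] ℤ.* + n)       ≡⟨ ≡.cong fromInt (ℤ.-◃n≡-n (suc m ℕ.* n)) ⟩
    fromInt (ℤ.- + (suc m ℕ.* n))    ≈⟨ -‿homo (+ (suc m ℕ.* n)) ⟩
    - ((suc m ℕ.* n) · 1#)           ≈⟨ -‿cong (×1-homo-* (suc m) n) ⟩
    - (suc m · 1# * n · 1#)          ≈⟨ -‿distribˡ-* _ _ ⟩
    - (suc m · 1#) * n · 1#          ∎
  *-homo -[1+ m ] -[1+ n ] = begin
    (suc m ℕ.* suc n) · 1#           ≈⟨ ×1-homo-* (suc m) (suc n) ⟩
    suc m · 1# * suc n · 1#          ≈⟨ ⁻¹-involutive _ ⟨
    - - (suc m · 1# * suc n · 1#)    ≈⟨ -‿cong (-‿distribʳ-* _ _) ⟩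
    - (suc m · 1# * - (suc n · 1#))  ≈⟨ -‿distribˡ-* _ _ ⟩
    - (suc m · 1#) * - (suc n · 1#)  ∎

  homomorphism : ℤ.+-*-rawRing -Raw-AlmostCommutative⟶ fromCommutativeRing C
  homomorphism = record
    { ⟦_⟧    = fromInt
    ; +-homo = +-homo
    ; *-homo = *-homo
    ; -‿homo = -‿homo
    ; 0-homo = refl
    ; 1-homo = refl
    }

  open Algebra.Solver.Ring ℤ.+-*-rawRing (fromCommutativeRing C) homomorphism
    (λ i j → map (λ i≡j → reflexive (≡.cong fromInt i≡j)) (dec⇒maybe (i ℤ.≟ j)))
    public using (solve; _:=_; _:+_; _:-_; _:*_; :-_; con)

-- Order and absolute value in a complete ordered field.

module OrderedField (em : ExcludedMiddle 0ℓ) (R : CompleteOrderedField) where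
  open CompleteOrderedField R hiding (zero)
  open IntegerCoefficients commutativeRing public
    using (solve; _:=_; _:+_; _:-_; _:*_; :-_; con)
  open TotalOrder totalOrder public
    using (poset; antisym; total; ≤-respˡ-≈; ≤-respʳ-≈)
    renaming (refl to ≤-refl; trans to ≤-trans; reflexive to ≤-reflexive)
  open ToStrict _≈_ _≤_ public using (<⇒≤)
  private module Max = NaturalMax totalOrder
  module ≤-Reasoning = PartialOrderReasoning poset
  open ≤-Reasoning

  ≰⇒> : ∀ {x y} → ¬ (x ≤ y) → y < x
  ≰⇒> = ToStrict.≰⇒> _≈_ _≤_ sym ≤-reflexive total

  ≮⇒≥ : ∀ {x y} → ¬ (x < y) → y ≤ x
  ≮⇒≥ = ToStrict.≮⇒≥ _≈_ _≤_ sym (λ _ _ → em) ≤-reflexive total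

  <⇒≱ : ∀ {x y} → x < y → ¬ (y ≤ x)
  <⇒≱ = ToStrict.<⇒≱ _≈_ _≤_ antisym

  <-≤-trans : ∀ {x y z} → x < y → y ≤ z → x < z
  <-≤-trans = ToStrict.<-≤-trans _≈_ _≤_ sym ≤-trans antisym ≤-respʳ-≈

  ≤-<-trans : ∀ {x y z} → x ≤ y → y < z → x < z
  ≤-<-trans = ToStrict.≤-<-trans _≈_ _≤_ ≤-trans antisym ≤-respˡ-≈

  +-monoʳ-≤ : ∀ z {x y} → x ≤ y → z + x ≤ z + y
  +-monoʳ-≤ z {x} {y} x≤y = begin
    z + x  ≈⟨ +-comm z x ⟩
    x + z  ≤⟨ +-monoˡ-≤ z x≤y ⟩
    y + z  ≈⟨ +-comm y z ⟩
    z + y  ∎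

  +-mono-≤ : ∀ {x y u v} → x ≤ y → u ≤ v → x + u ≤ y + v
  +-mono-≤ x≤y u≤v = ≤-trans (+-monoˡ-≤ _ x≤y) (+-monoʳ-≤ _ u≤v)

  +-cancelʳ-≤ : ∀ z {x y} → x + z ≤ y + z → x ≤ y
  +-cancelʳ-≤ z {x} {y} x+z≤y+z = begin
    x          ≈⟨ solve 2 (λ x z → x := x :+ z :- z) refl x z ⟩
    x + z - z  ≤⟨ +-monoˡ-≤ (- z) x+z≤y+z ⟩
    y + z - z  ≈⟨ solve 2 (λ y z → y :+ z :- z := y) refl y z ⟩
    y          ∎

  +-monoˡ-< : ∀ z {x y} → x < y → x + z < y + z
  +-monoˡ-< z x<y = ≰⇒> (<⇒≱ x<y ∘ +-cancelʳ-≤ z)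

  +-cancelʳ-< : ∀ z {x y} → x + z < y + z → x < y
  +-cancelʳ-< z x+z<y+z = ≰⇒> (<⇒≱ x+z<y+z ∘ +-monoˡ-≤ z)

  +-mono-<-≤ : ∀ {x y u v} → x < y → u ≤ v → x + u < y + v
  +-mono-<-≤ x<y u≤v = <-≤-trans (+-monoˡ-< _ x<y) (+-monoʳ-≤ _ u≤v)

  +-mono-< : ∀ {x y u v} → x < y → u < v → x + u < y + v
  +-mono-< x<y u<v = +-mono-<-≤ x<y (<⇒≤ u<v)

  x≤y⇒0≤y-x : ∀ {x y} → x ≤ y → 0# ≤ y - x
  x≤y⇒0≤y-x {x} {y} x≤y = begin
    0#     ≈⟨ -‿inverseʳ x ⟨
    x - x  ≤⟨ +-monoˡ-≤ (- x) x≤y ⟩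
    y - x  ∎

  0≤y-x⇒x≤y : ∀ {x y} → 0# ≤ y - x → x ≤ y
  0≤y-x⇒x≤y {x} {y} 0≤y-x = begin
    x          ≈⟨ +-identityˡ x ⟨
    0# + x     ≤⟨ +-monoˡ-≤ x 0≤y-x ⟩
    y - x + x  ≈⟨ solve 2 (λ x y → y :- x :+ x := y) refl x y ⟩
    y          ∎

  -‿anti-≤ : ∀ {x y} → x ≤ y → - y ≤ - x
  -‿anti-≤ {x} {y} x≤y = 0≤y-x⇒x≤y (begin
    0#         ≤⟨ x≤y⇒0≤y-x x≤y ⟩
    y - x      ≈⟨ solve 2 (λ x y → y :- x := :- x :- :- y) refl x y ⟩
    - x - - y  ∎)

  x≤0⇒0≤-x : ∀ {x} → x ≤ 0# → 0# ≤ - x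
  x≤0⇒0≤-x {x} x≤0 = begin
    0#    ≈⟨ solve 0 (con (+ 0) := :- con (+ 0)) refl ⟩
    - 0#  ≤⟨ -‿anti-≤ x≤0 ⟩
    - x   ∎

  x-y≤z⇒x≤z+y : ∀ {x y z} → x - y ≤ z → x ≤ z + y
  x-y≤z⇒x≤z+y {x} {y} {z} x-y≤z = begin
    x          ≈⟨ solve 2 (λ x y → x := x :- y :+ y) refl x y ⟩
    x - y + y  ≤⟨ +-monoˡ-≤ y x-y≤z ⟩
    z + y      ∎

  x≤z+y⇒x-y≤z : ∀ {x y z} → x ≤ z + y → x - y ≤ z
  x≤z+y⇒x-y≤z {x} {y} {z} x≤z+y = +-cancelʳ-≤ y (begin
    x - y + y  ≈⟨ solve 2 (λ x y → x :- y :+ y := x) refl x y ⟩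
    x          ≤⟨ x≤z+y ⟩
    z + y      ∎)

  *-monoˡ-≤ : ∀ {c x y} → 0# ≤ c → x ≤ y → c * x ≤ c * y
  *-monoˡ-≤ {c} {x} {y} 0≤c x≤y = 0≤y-x⇒x≤y (begin
    0#             ≤⟨ *-nonNeg 0≤c (x≤y⇒0≤y-x x≤y) ⟩
    c * (y - x)    ≈⟨ solve 3 (λ c x y → c :* (y :- x) := c :* y :- c :* x) refl c x y ⟩
    c * y - c * x  ∎)

  *-monoʳ-≤ : ∀ {c x y} → 0# ≤ c → x ≤ y → x * c ≤ y * c
  *-monoʳ-≤ {c} {x} {y} 0≤c x≤y = begin
    x * c  ≈⟨ *-comm x c ⟩
    c * x  ≤⟨ *-monoˡ-≤ 0≤c x≤y ⟩
    c * y  ≈⟨ *-comm c y ⟩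
    y * c  ∎

  0≤1 : 0# ≤ 1#
  0≤1 with total 0# 1#
  ... | inj₁ 0≤1 = 0≤1
  ... | inj₂ 1≤0 = begin
    0#             ≤⟨ *-nonNeg (x≤0⇒0≤-x 1≤0) (x≤0⇒0≤-x 1≤0) ⟩
    - 1# * - 1#    ≈⟨ solve 0 (:- con (+ 1) :* :- con (+ 1) := con (+ 1)) refl ⟩
    1#             ∎

  0<1 : 0# < 1#
  0<1 = 0≤1 , 0≉1

  0<⇒≉0 : ∀ {x} → 0# < x → x ≉ 0#
  0<⇒≉0 (_ , 0≉x) x≈0 = 0≉x (sym x≈0)

  0<x⇒0<x⁻¹ : ∀ {x} → 0# < x → 0# < x ⁻¹
  0<x⇒0<x⁻¹ {x} 0<x = ≰⇒> λ x⁻¹≤0 → <⇒≱ 0<1 (begin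
    1#        ≈⟨ ⁻¹-inverseʳ (0<⇒≉0 0<x) ⟨
    x * x ⁻¹  ≤⟨ *-monoˡ-≤ (<⇒≤ 0<x) x⁻¹≤0 ⟩
    x * 0#    ≈⟨ zeroʳ x ⟩
    0#        ∎)

  x*[x⁻¹*y]≈y : ∀ {x} → 0# < x → ∀ y → x * (x ⁻¹ * y) ≈ y
  x*[x⁻¹*y]≈y {x} 0<x y =
    trans (sym (*-assoc x _ y)) (trans (*-congʳ (⁻¹-inverseʳ (0<⇒≉0 0<x))) (*-identityˡ y))

  x⁻¹*[x*y]≈y : ∀ {x} → 0# < x → ∀ y → x ⁻¹ * (x * y) ≈ y
  x⁻¹*[x*y]≈y {x} 0<x y =
    trans (solve 3 (λ x x⁻¹ y → x⁻¹ :* (x :* y) := x :* (x⁻¹ :* y)) refl x (x ⁻¹) y)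
          (x*[x⁻¹*y]≈y 0<x y)

  *-cancelˡ-≤ : ∀ {c x y} → 0# < c → c * x ≤ c * y → x ≤ y
  *-cancelˡ-≤ {c} {x} {y} 0<c cx≤cy = begin
    x               ≈⟨ x⁻¹*[x*y]≈y 0<c x ⟨
    c ⁻¹ * (c * x)  ≤⟨ *-monoˡ-≤ (<⇒≤ (0<x⇒0<x⁻¹ 0<c)) cx≤cy ⟩
    c ⁻¹ * (c * y)  ≈⟨ x⁻¹*[x*y]≈y 0<c y ⟩
    y               ∎

  *-monoˡ-< : ∀ {c x y} → 0# < c → x < y → c * x < c * y
  *-monoˡ-< 0<c x<y = ≰⇒> (<⇒≱ x<y ∘ *-cancelˡ-≤ 0<c)

  *-cancelˡ-< : ∀ {c x y} → 0# ≤ c → c * x < c * y → x < y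
  *-cancelˡ-< 0≤c cx<cy = ≰⇒> (<⇒≱ cx<cy ∘ *-monoˡ-≤ 0≤c)

  *-pos : ∀ {x y} → 0# < x → 0# < y → 0# < x * y
  *-pos {x} {y} 0<x 0<y = begin-strict
    0#      ≈⟨ zeroʳ x ⟨
    x * 0#  <⟨ *-monoˡ-< 0<x 0<y ⟩
    x * y   ∎

  +-pos : ∀ {x y} → 0# < x → 0# ≤ y → 0# < x + y
  +-pos {x} {y} 0<x 0≤y = ≤-<-trans (≤-reflexive (sym (+-identityˡ 0#))) (+-mono-<-≤ 0<x 0≤y)

  +-nonNeg : ∀ {x y} → 0# ≤ x → 0# ≤ y → 0# ≤ x + y
  +-nonNeg {x} {y} 0≤x 0≤y = ≤-trans (≤-reflexive (sym (+-identityˡ 0#))) (+-mono-≤ 0≤x 0≤y)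

  x≤x+y : ∀ {x y} → 0# ≤ y → x ≤ x + y
  x≤x+y {x} 0≤y = ≤-trans (≤-reflexive (sym (+-identityʳ x))) (+-monoʳ-≤ x 0≤y)

  y≤x+y : ∀ {x y} → 0# ≤ x → y ≤ x + y
  y≤x+y {x} {y} 0≤x = ≤-trans (≤-reflexive (sym (+-identityˡ y))) (+-monoˡ-≤ y 0≤x)

  x-y<x : ∀ {x y} → 0# < y → x - y < x
  x-y<x {x} {y} 0<y = begin-strict
    x - y         ≈⟨ +-identityˡ _ ⟨
    0# + (x - y)  <⟨ +-monoˡ-< (x - y) 0<y ⟩
    y + (x - y)   ≈⟨ solve 2 (λ x y → y :+ (x :- y) := x) refl x y ⟩
    x             ∎

  x<x+y : ∀ {x y} → 0# < y → x < x + y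
  x<x+y {x} {y} 0<y = begin-strict
    x       ≈⟨ +-identityˡ x ⟨
    0# + x  <⟨ +-monoˡ-< x 0<y ⟩
    y + x   ≈⟨ +-comm y x ⟩
    x + y   ∎

  2# : ℝ
  2# = 1# + 1#

  0<2 : 0# < 2#
  0<2 = +-pos 0<1 0≤1

  ½ : ℝ
  ½ = 2# ⁻¹

  0<½ : 0# < ½
  0<½ = 0<x⇒0<x⁻¹ 0<2

  ½x+½x≈x : ∀ x → ½ * x + ½ * x ≈ x
  ½x+½x≈x x = trans
    (solve 2 (λ h x → h :* x :+ h :* x := (con (+ 1) :+ con (+ 1)) :* (h :* x)) refl ½ x)
    (x*[x⁻¹*y]≈y 0<2 x)

  2*[½*x]≈x : ∀ x → 2# * (½ * x) ≈ x
  2*[½*x]≈x = x*[x⁻¹*y]≈y 0<2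

  -- For positive `x` the choice `ε = K ⁻¹ * (½ * x)` would give `x ≤ ½ * x`.
  ≤-infinitesimal⇒≤0 : ∀ {x} K → 0# < K → (∀ ε → 0# < ε → x ≤ K * ε) → x ≤ 0#
  ≤-infinitesimal⇒≤0 {x} K 0<K x≤K* = ≮⇒≥ λ 0<x →
    let 0<½x = *-pos 0<½ 0<x in
    <⇒≱ 0<½x (+-cancelʳ-≤ (½ * x) (begin
      ½ * x + ½ * x        ≈⟨ ½x+½x≈x x ⟩
      x                    ≤⟨ x≤K* (K ⁻¹ * (½ * x)) (*-pos (0<x⇒0<x⁻¹ 0<K) 0<½x) ⟩
      K * (K ⁻¹ * (½ * x)) ≈⟨ x*[x⁻¹*y]≈y 0<K _ ⟩
      ½ * x                ≈⟨ +-identityˡ _ ⟨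
      0# + ½ * x           ∎))

  x≤∣x∣ : ∀ x → x ≤ ∣ x ∣
  x≤∣x∣ x = Max.x≤x⊔y x (- x)

  -x≤∣x∣ : ∀ x → - x ≤ ∣ x ∣
  -x≤∣x∣ x = Max.x≤y⊔x x (- x)

  ∣∣-lub : ∀ {x b} → x ≤ b → - x ≤ b → ∣ x ∣ ≤ b
  ∣∣-lub = Max.⊔-lub

  ∣∣-lub-< : ∀ {x b} → x < b → - x < b → ∣ x ∣ < b
  ∣∣-lub-< {x} x<b -x<b with Max.⊔-sel x (- x)
  ... | inj₁ ∣x∣≈x  = ≤-<-trans (≤-reflexive ∣x∣≈x) x<b
  ... | inj₂ ∣x∣≈-x = ≤-<-trans (≤-reflexive ∣x∣≈-x) -x<b

  ∣∣-cong-≤ : ∀ {x y} → x ≈ y → ∣ x ∣ ≤ ∣ y ∣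
  ∣∣-cong-≤ {x} {y} x≈y =
    ∣∣-lub (≤-trans (≤-reflexive x≈y) (x≤∣x∣ y))
           (≤-trans (≤-reflexive (-‿cong x≈y)) (-x≤∣x∣ y))

  ∣-x∣≤∣x∣ : ∀ x → ∣ - x ∣ ≤ ∣ x ∣
  ∣-x∣≤∣x∣ x = ∣∣-lub (-x≤∣x∣ x)
    (≤-trans (≤-reflexive (solve 1 (λ x → :- :- x := x) refl x)) (x≤∣x∣ x))

  0≤∣x∣ : ∀ x → 0# ≤ ∣ x ∣
  0≤∣x∣ x with total 0# x
  ... | inj₁ 0≤x = ≤-trans 0≤x (x≤∣x∣ x)
  ... | inj₂ x≤0 = ≤-trans (x≤0⇒0≤-x x≤0) (-x≤∣x∣ x)

  ∣x∣≤x : ∀ {x} → 0# ≤ x → ∣ x ∣ ≤ x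
  ∣x∣≤x {x} 0≤x = ∣∣-lub ≤-refl (begin
    - x    ≤⟨ -‿anti-≤ 0≤x ⟩
    - 0#   ≈⟨ solve 0 (:- con (+ 0) := con (+ 0)) refl ⟩
    0#     ≤⟨ 0≤x ⟩
    x      ∎)

  ∣-1∣≤1 : ∣ - 1# ∣ ≤ 1#
  ∣-1∣≤1 = ≤-trans (∣-x∣≤∣x∣ 1#) (∣x∣≤x 0≤1)

  ∣x+y∣≤∣x∣+∣y∣ : ∀ x y → ∣ x + y ∣ ≤ ∣ x ∣ + ∣ y ∣
  ∣x+y∣≤∣x∣+∣y∣ x y = ∣∣-lub (+-mono-≤ (x≤∣x∣ x) (x≤∣x∣ y)) (begin
    - (x + y)      ≈⟨ solve 2 (λ x y → :- (x :+ y) := :- x :- y) refl x y ⟩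
    - x - y        ≤⟨ +-mono-≤ (-x≤∣x∣ x) (-x≤∣x∣ y) ⟩
    ∣ x ∣ + ∣ y ∣  ∎)

  ∣x*y∣≤x*∣y∣ : ∀ {x} → 0# ≤ x → ∀ y → ∣ x * y ∣ ≤ x * ∣ y ∣
  ∣x*y∣≤x*∣y∣ {x} 0≤x y = ∣∣-lub (*-monoˡ-≤ 0≤x (x≤∣x∣ y)) (begin
    - (x * y)  ≈⟨ solve 2 (λ x y → :- (x :* y) := x :* :- y) refl x y ⟩
    x * - y    ≤⟨ *-monoˡ-≤ 0≤x (-x≤∣x∣ y) ⟩
    x * ∣ y ∣  ∎)

  ∣x*y∣≤∣x∣*∣y∣ : ∀ x y → ∣ x * y ∣ ≤ ∣ x ∣ * ∣ y ∣
  ∣x*y∣≤∣x∣*∣y∣ x y with total 0# x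
  ... | inj₁ 0≤x = ≤-trans (∣x*y∣≤x*∣y∣ 0≤x y) (*-monoʳ-≤ (0≤∣x∣ y) (x≤∣x∣ x))
  ... | inj₂ x≤0 = begin
    ∣ x * y ∣         ≤⟨ ∣∣-cong-≤ (solve 2 (λ x y → x :* y := :- (:- x :* y)) refl x y) ⟩
    ∣ - (- x * y) ∣   ≤⟨ ∣-x∣≤∣x∣ _ ⟩
    ∣ - x * y ∣       ≤⟨ ∣x*y∣≤x*∣y∣ (x≤0⇒0≤-x x≤0) y ⟩
    - x * ∣ y ∣       ≤⟨ *-monoʳ-≤ (0≤∣x∣ y) (-x≤∣x∣ x) ⟩
    ∣ x ∣ * ∣ y ∣     ∎

  0≤fromℕ : ∀ n → 0# ≤ fromℕ n
  0≤fromℕ zero    = ≤-refl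
  0≤fromℕ (suc n) = +-nonNeg 0≤1 (0≤fromℕ n)

  0<fromℕ : ∀ n → .{{ℕ.NonZero n}} → 0# < fromℕ n
  0<fromℕ (suc n) = +-pos 0<1 (0≤fromℕ n)

  fromℕ-mono-≤ : ∀ {m n} → m ℕ.≤ n → fromℕ m ≤ fromℕ n
  fromℕ-mono-≤ {n = n} ℕ.z≤n = 0≤fromℕ n
  fromℕ-mono-≤ (ℕ.s≤s m≤n)   = +-monoʳ-≤ 1# (fromℕ-mono-≤ m≤n)

  fromℕ∣i∣≤∣fromℤ∣ : ∀ i → fromℕ ℤ.∣ i ∣ ≤ ∣ fromℤ i ∣
  fromℕ∣i∣≤∣fromℤ∣ (+ n)    = x≤∣x∣ _
  fromℕ∣i∣≤∣fromℤ∣ -[1+ n ] =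
    ≤-trans (≤-reflexive (solve 1 (λ x → x := :- :- x) refl _)) (-x≤∣x∣ _)

  IsSupremum-approx : ∀ {P v} → IsSupremum P v → ∀ {b} → b < v → ∃[ x ] (P x × b < x)
  IsSupremum-approx {P} (_ , least) {b} b<v with em {∃[ x ] (P x × b < x)}
  ... | yes x = x
  ... | no ∄x = contradiction
    (least b λ x Px → ≮⇒≥ λ b<x → ∄x (x , Px , b<x)) (<⇒≱ b<v)

  IsInfimum-approx : ∀ {P v} → IsInfimum P v → ∀ {b} → v < b → ∃[ x ] (P x × x < b)
  IsInfimum-approx {P} (_ , greatest) {b} v<b with em {∃[ x ] (P x × x < b)}
  ... | yes x = x
  ... | no ∄x = contradiction
    (greatest b λ x Px → ≮⇒≥ λ x<b → ∄x (x , Px , x<b)) (<⇒≱ v<b)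

  -- If the naturals were bounded, one of them would lie within 1 of their supremum `v`, and its
  -- successor would exceed `v`.
  archimedean : ∀ x → ∃[ n ] x < fromℕ n
  archimedean x with em {∃[ n ] x < fromℕ n}
  ... | yes n = n
  ... | no ∄n =
    let naturals y = ∃[ n ] y ≈ fromℕ n
        v , isSup@(ub , _) = complete naturals (0# , 0 , refl)
          (x , λ y (n , y≈n) → ≤-trans (≤-reflexive y≈n) (≮⇒≥ λ x<n → ∄n (n , x<n)))
        y , (n , y≈n) , v-1<y = IsSupremum-approx isSup (x-y<x {v} 0<1)
    in contradiction (ub (fromℕ (suc n)) (suc n , refl)) (<⇒≱ (begin-strict
      v                ≈⟨ solve 1 (λ v → v := v :- con (+ 1) :+ con (+ 1)) refl v ⟩
      v - 1# + 1#      <⟨ +-monoˡ-< 1# v-1<y ⟩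
      y + 1#           ≈⟨ +-congʳ y≈n ⟩
      fromℕ n + 1#     ≈⟨ +-comm _ _ ⟩
      1# + fromℕ n     ∎))

-- Suprema that are maxima.

Finite : {A : Set} → Pred A 0ℓ → Set
Finite {A} P = ∃[ xs ] (∀ (a : A) → P a → a ∈ xs)

module Suprema (em : ExcludedMiddle 0ℓ) (R : CompleteOrderedField) where
  open CompleteOrderedField R hiding (zero)
  open Analysis em R
  open OrderedField em R

  sup-isSupremum : ∀ P → Satisfiable P → Satisfiable (IsUpperBound P) → IsSupremum P (sup P)
  sup-isSupremum P nonempty bounded with em {Satisfiable P × Satisfiable (IsUpperBound P)}
  ... | yes (nonempty′ , bounded′) = proj₂ (complete P nonempty′ bounded′)
  ... | no ¬supremum               = contradiction (nonempty , bounded) ¬supremum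

  maximum⇒supremumAttained : {I : Set} (f : I → ℝ) (j : I) → (∀ i → f i ≤ f j) →
                             SupremumAttained f
  maximum⇒supremumAttained f j f≤fj =
    isSup , j , antisym (proj₂ isSup (f j) upper) (proj₁ isSup (f j) (j , refl))
    where
    upper : IsUpperBound (Range f) (f j)
    upper y (i , y≈fi) = ≤-trans (≤-reflexive y≈fi) (f≤fj i)

    isSup : IsSupremum (Range f) (⨆ f)
    isSup = sup-isSupremum (Range f) (f j , j , refl) (f j , upper)

  ≤⨆ : {I : Set} {f : I → ℝ} → SupremumAttained f → ∀ i → f i ≤ ⨆ f
  ≤⨆ {f = f} ((upper , _) , _) i = upper (f i) (i , refl)

  module _ {A : Set} {Q : Pred A 0ℓ} (g : A → ℝ) where

    -- A covering list may contain elements outside `Q` and may even be empty. The scan therefore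
    -- starts from a given `i` in `Q` and never falls below it, whether or not `i` occurs in `xs`.
    maximumOn : (xs : List A) (i : Σ A Q) →
                ∃[ j ] (g (proj₁ i) ≤ g (proj₁ {B = Q} j) ×
                        (∀ a → Q a → a ∈ xs → g a ≤ g (proj₁ j)))
    maximumOn []       i = i , ≤-refl , λ _ _ ()
    maximumOn (x ∷ xs) i with maximumOn xs i
    ... | j , gi≤gj , max with em {Q x × g (proj₁ j) < g x}
    ...   | yes (Qx , gj<gx) = (x , Qx) , ≤-trans gi≤gj (<⇒≤ gj<gx) , λ where
      _ _  (here ≡.refl) → ≤-refl
      a Qa (there a∈xs)  → ≤-trans (max a Qa a∈xs) (<⇒≤ gj<gx)
    ...   | no ¬larger = j , gi≤gj , λ where
      _ Qx (here ≡.refl) → ≮⇒≥ λ gj<gx → ¬larger (Qx , gj<gx)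
      a Qa (there a∈xs)  → max a Qa a∈xs

    -- A positive value `g i` serves as threshold: smaller values are beaten by `i` itself, and the
    -- others occur in a finite list. If no value is positive, all of them are 0 and every index is
    -- maximal.
    vanishing⇒supremumAttained : (∀ a → 0# ≤ g a) → (∀ ε → 0# < ε → Finite (λ a → ε ≤ g a)) →
                                 Satisfiable Q → SupremumAttained {I = Σ A Q} (g ∘ proj₁)
    vanishing⇒supremumAttained 0≤g finite i₀ with em {∃[ i ] 0# < g (proj₁ {B = Q} i)}
    ... | no ∄i = maximum⇒supremumAttained (g ∘ proj₁) i₀ λ i →
      ≤-trans (≮⇒≥ λ 0<gi → ∄i (i , 0<gi)) (0≤g (proj₁ i₀))
    ... | yes (i , 0<gi) = maximum⇒supremumAttained (g ∘ proj₁) j maximal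
      where
      xs   = proj₁ (finite (g (proj₁ i)) 0<gi)
      maxi = maximumOn xs i
      j    = proj₁ maxi

      maximal : ∀ k → g (proj₁ k) ≤ g (proj₁ j)
      maximal (a , Qa) with total (g (proj₁ i)) (g a)
      ... | inj₁ gi≤ga = proj₂ (proj₂ maxi) a Qa (proj₂ (finite _ 0<gi) a gi≤ga)
      ... | inj₂ ga≤gi = ≤-trans ga≤gi (proj₁ (proj₂ maxi))

-- Equivalence of norms on ℝˢ.

module Norms (em : ExcludedMiddle 0ℓ) (R : CompleteOrderedField) where
  open CompleteOrderedField R hiding (zero)
  open Analysis em R
  open OrderedField em R
  open ≤-Reasoning

  _∷ᵛ_ : ∀ {s} → ℝ → Vector ℝ s → Vector ℝ (suc s)
  _∷ᵛ_ = Vector._∷_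

  infixr 5 _∷ᵛ_

  ∷ᵛ-≋ : ∀ {s} {x : Vector ℝ (suc s)} {y : Vector ℝ (suc s)} →
         x zero ≈ y zero → (∀ i → x (suc i) ≈ y (suc i)) → ∀ i → x i ≈ y i
  ∷ᵛ-≋ head≈ tail≈ zero    = head≈
  ∷ᵛ-≋ head≈ tail≈ (suc i) = tail≈ i

  e₀ : ∀ {s} → Vector ℝ (suc s)
  e₀ = 1# ∷ᵛ λ _ → 0#

  restrict-isNorm : ∀ {s} {‖_‖ : Vector ℝ (suc s) → ℝ} → IsNorm ‖_‖ →
                    IsNorm (λ z → ‖ 0# ∷ᵛ z ‖)
  restrict-isNorm isNorm = record
    { ‖‖-cong     = λ x≋y → ‖‖-cong (∷ᵛ-≋ refl x≋y)
    ; nonNegative = λ z → nonNegative _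
    ; definite    = λ z ‖z‖≈0 i → definite _ ‖z‖≈0 (suc i)
    ; homogeneous = λ a z → trans (‖‖-cong (∷ᵛ-≋ (sym (zeroʳ a)) λ _ → refl)) (homogeneous a _)
    ; triangle    = λ y z → ≤-respˡ-≈ (‖‖-cong (∷ᵛ-≋ (+-identityˡ 0#) λ _ → refl)) (triangle _ _)
    }
    where open IsNorm isNorm

  -- Writing `z` as `z zero` times `e₀` plus a vector of the hyperplane adds `‖ e₀ ‖` to the
  -- constant in each dimension. In dimension 0 every vector is `0#` times itself, so its norm
  -- vanishes by homogeneity.
  norm-bounded : ∀ {s} {‖_‖ : Vector ℝ s → ℝ} → IsNorm ‖_‖ →
                 ∃[ B ] (0# < B × (∀ z d → 0# ≤ d → (∀ i → ∣ z i ∣ ≤ d) → ‖ z ‖ ≤ B * d))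
  norm-bounded {zero} {‖_‖} isNorm = 1# , 0<1 , λ z d 0≤d _ → begin
    ‖ z ‖                   ≈⟨ ‖‖-cong (λ ()) ⟩
    ‖ (λ i → 0# * z i) ‖    ≈⟨ homogeneous 0# z ⟩
    ∣ 0# ∣ * ‖ z ‖          ≤⟨ *-monoʳ-≤ (nonNegative z) (∣x∣≤x ≤-refl) ⟩
    0# * ‖ z ‖              ≈⟨ zeroˡ _ ⟩
    0#                      ≤⟨ 0≤d ⟩
    d                       ≈⟨ *-identityˡ d ⟨
    1# * d                  ∎
    where open IsNorm isNorm
  norm-bounded {suc s} {‖_‖} isNorm with norm-bounded (restrict-isNorm isNorm)
  ... | B , 0<B , tail-bounded = B + ‖ e₀ ‖ , +-pos 0<B (nonNegative e₀) , λ z d 0≤d ∣z∣≤d → begin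
    ‖ z ‖
      ≈⟨ ‖‖-cong (∷ᵛ-≋ (trans (sym (*-identityʳ _)) (sym (+-identityʳ _)))
                       (λ i → trans (sym (+-identityˡ _)) (+-congʳ (sym (zeroʳ _))))) ⟩
    ‖ (λ i → z zero * e₀ i + (0# ∷ᵛ tail z) i) ‖
      ≤⟨ triangle _ _ ⟩
    ‖ (λ i → z zero * e₀ i) ‖ + ‖ 0# ∷ᵛ tail z ‖
      ≈⟨ +-congʳ (homogeneous (z zero) e₀) ⟩
    ∣ z zero ∣ * ‖ e₀ ‖ + ‖ 0# ∷ᵛ tail z ‖
      ≤⟨ +-mono-≤ (*-monoʳ-≤ (nonNegative e₀) (∣z∣≤d zero)) (tail-bounded (tail z) d 0≤d (∣z∣≤d ∘ suc)) ⟩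
    d * ‖ e₀ ‖ + B * d
      ≈⟨ solve 3 (λ B n d → d :* n :+ B :* d := (B :+ n) :* d) refl B (‖ e₀ ‖) d ⟩
    (B + ‖ e₀ ‖) * d  ∎
    where open IsNorm isNorm

  -- The slice of vectors with first coordinate 1 keeps away from the origin:
  -- otherwise points of it approaching the origin would converge coordinatewise,
  -- and their limit would be a nonzero vector of norm 0.
  module _ {s} {‖_‖ : Vector ℝ (suc s) → ℝ} (isNorm : IsNorm ‖_‖)
           (C : ℝ) (0<C : 0# < C)
           (coordinate≤ : ∀ z i → ∣ z i ∣ ≤ C * ‖ 0# ∷ᵛ z ‖) where
    open IsNorm isNorm

    -- The Cauchy property of points of the slice that approach the origin: the difference of two of
    -- them lies in the hyperplane, where the induction hypothesis `coordinate≤` applies.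
    slices-close : ∀ {ε u w} → ‖ 1# ∷ᵛ u ‖ < ε → ‖ 1# ∷ᵛ w ‖ < ε →
                   ∀ i → u i - w i ≤ C * (ε + ε)
    slices-close {ε} {u} {w} ‖u‖<ε ‖w‖<ε i = begin
      u i - w i                                       ≤⟨ x≤∣x∣ _ ⟩
      ∣ u i - w i ∣                                   ≤⟨ coordinate≤ (λ j → u j - w j) i ⟩
      C * ‖ 0# ∷ᵛ (λ j → u j - w j) ‖                 ≤⟨ *-monoˡ-≤ (<⇒≤ 0<C) (begin
        ‖ 0# ∷ᵛ (λ j → u j - w j) ‖
          ≈⟨ ‖‖-cong (∷ᵛ-≋ (solve 0 (con (+ 0) := con (+ 1) :+ (:- con (+ 1)) :* con (+ 1)) refl)
                           (λ j → solve 2 (λ u w → u :- w := u :+ (:- con (+ 1)) :* w) refl (u j) (w j))) ⟩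
        ‖ (λ j → (1# ∷ᵛ u) j + - 1# * (1# ∷ᵛ w) j) ‖  ≤⟨ triangle _ _ ⟩
        ‖ 1# ∷ᵛ u ‖ + ‖ (λ j → - 1# * (1# ∷ᵛ w) j) ‖  ≈⟨ +-congˡ (homogeneous (- 1#) (1# ∷ᵛ w)) ⟩
        ‖ 1# ∷ᵛ u ‖ + ∣ - 1# ∣ * ‖ 1# ∷ᵛ w ‖          ≤⟨ +-monoʳ-≤ _ (*-monoʳ-≤ (nonNegative _) ∣-1∣≤1) ⟩
        ‖ 1# ∷ᵛ u ‖ + 1# * ‖ 1# ∷ᵛ w ‖                ≈⟨ +-congˡ (*-identityˡ _) ⟩
        ‖ 1# ∷ᵛ u ‖ + ‖ 1# ∷ᵛ w ‖                     ≤⟨ +-mono-≤ (<⇒≤ ‖u‖<ε) (<⇒≤ ‖w‖<ε) ⟩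
        ε + ε                                         ∎) ⟩
      C * (ε + ε)                                     ∎

    module _ (approach : ∀ ε → 0# < ε → ∃[ z ] ‖ 1# ∷ᵛ z ‖ < ε) where

      -- The supremum of this set is the lower limit of `u i` as `‖ 1# ∷ᵛ u ‖` tends to 0. It
      -- replaces the limit of a sequence, so no approximating sequence has to be chosen.
      EventualLowerBound : Fin s → Pred ℝ 0ℓ
      EventualLowerBound i t = ∃[ ε ] (0# < ε × (∀ u → ‖ 1# ∷ᵛ u ‖ < ε → t ≤ u i))

      lowerBound : ∀ i {ε} → 0# < ε → ∀ u → ‖ 1# ∷ᵛ u ‖ < ε →
                   EventualLowerBound i (u i - C * (ε + ε))
      lowerBound i {ε} 0<ε u ‖u‖<ε = ε , 0<ε , λ w ‖w‖<ε → begin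
        u i - C * (ε + ε)                  ≤⟨ x≤z+y⇒x-y≤z (begin
          u i                  ≤⟨ x-y≤z⇒x≤z+y (slices-close ‖u‖<ε ‖w‖<ε i) ⟩
          C * (ε + ε) + w i    ≈⟨ +-comm _ _ ⟩
          w i + C * (ε + ε)    ∎) ⟩
        w i                                ∎

      -- A lower bound `t` valid below a smaller `ε′` says nothing about `u` directly. A point `w`
      -- of norm below `ε′` links them: `t ≤ w i`, and `w i` is close to `u i`.
      upperBound : ∀ i {ε} → 0# < ε → ∀ u → ‖ 1# ∷ᵛ u ‖ < ε →
                   IsUpperBound (EventualLowerBound i) (C * (ε + ε) + u i)
      upperBound i {ε} 0<ε u ‖u‖<ε t (ε′ , 0<ε′ , t≤) with total ε ε′
      ... | inj₁ ε≤ε′ = ≤-trans (t≤ u (<-≤-trans ‖u‖<ε ε≤ε′))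
        (y≤x+y (*-nonNeg (<⇒≤ 0<C) (+-nonNeg (<⇒≤ 0<ε) (<⇒≤ 0<ε))))
      ... | inj₂ ε′≤ε with approach ε′ 0<ε′
      ...   | w , ‖w‖<ε′ = ≤-trans (t≤ w ‖w‖<ε′)
        (x-y≤z⇒x≤z+y (slices-close (<-≤-trans ‖w‖<ε′ ε′≤ε) ‖u‖<ε i))

      supremum-close : ∀ i {t} → IsSupremum (EventualLowerBound i) t →
                       ∀ {ε} → 0# < ε → ∀ u → ‖ 1# ∷ᵛ u ‖ < ε → ∣ t - u i ∣ ≤ C * (ε + ε)
      supremum-close i {t} (upper , least) {ε} 0<ε u ‖u‖<ε = ∣∣-lub
        (x≤z+y⇒x-y≤z (least _ (upperBound i 0<ε u ‖u‖<ε)))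
        (begin
          - (t - u i)   ≈⟨ solve 2 (λ t u → :- (t :- u) := u :- t) refl t (u i) ⟩
          u i - t       ≤⟨ x≤z+y⇒x-y≤z (begin
            u i                ≤⟨ x-y≤z⇒x≤z+y (upper _ (lowerBound i 0<ε u ‖u‖<ε)) ⟩
            t + C * (ε + ε)    ≈⟨ +-comm _ _ ⟩
            C * (ε + ε) + t    ∎) ⟩
          C * (ε + ε)   ∎)

      coordinate-limit : ∀ i → ∃[ t ] (∀ {ε} → 0# < ε → ∀ u → ‖ 1# ∷ᵛ u ‖ < ε →
                                       ∣ t - u i ∣ ≤ C * (ε + ε))
      coordinate-limit i =
        -- The radius 1 is arbitrary: a single point of the slice shows the set to be nonempty and
        -- bounded.
        let v , ‖v‖<1 = approach 1# 0<1
            t , isSup = complete (EventualLowerBound i)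
                          (_ , lowerBound i 0<1 v ‖v‖<1) (_ , upperBound i 0<1 v ‖v‖<1)
        in t , supremum-close i isSup

      -- The vector is a slice point of norm below `ε` plus a hyperplane vector with coordinates at
      -- most `C * (ε + ε)`. Coordinatewise closeness becomes closeness in norm by `norm-bounded`,
      -- and `K` collects the constants.
      ‖limit‖≤0 : (t : Vector ℝ s) →
                  (∀ i {ε} → 0# < ε → ∀ u → ‖ 1# ∷ᵛ u ‖ < ε → ∣ t i - u i ∣ ≤ C * (ε + ε)) →
                  ‖ 1# ∷ᵛ t ‖ ≤ 0#
      ‖limit‖≤0 t close with norm-bounded (restrict-isNorm isNorm)
      ... | B , 0<B , bounded =
        ≤-infinitesimal⇒≤0 K (+-pos 0<1 (<⇒≤ (*-pos 0<B (*-pos 0<C 0<2)))) λ ε 0<ε →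
          let u , ‖u‖<ε = approach ε 0<ε in begin
          ‖ 1# ∷ᵛ t ‖
            ≈⟨ ‖‖-cong (∷ᵛ-≋ (sym (+-identityʳ 1#))
                 (λ i → solve 2 (λ t u → t := u :+ (t :- u)) refl (t i) (u i))) ⟩
          ‖ (λ i → (1# ∷ᵛ u) i + (0# ∷ᵛ (λ j → t j - u j)) i) ‖
            ≤⟨ triangle _ _ ⟩
          ‖ 1# ∷ᵛ u ‖ + ‖ 0# ∷ᵛ (λ j → t j - u j) ‖
            ≤⟨ +-mono-≤ (<⇒≤ ‖u‖<ε)
                 (bounded _ _ (*-nonNeg (<⇒≤ 0<C) (+-nonNeg (<⇒≤ 0<ε) (<⇒≤ 0<ε)))
                          (λ i → close i 0<ε u ‖u‖<ε)) ⟩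
          ε + B * (C * (ε + ε))
            ≈⟨ solve 3 (λ B C ε → ε :+ B :* (C :* (ε :+ ε)) :=
                          (con (+ 1) :+ B :* (C :* (con (+ 1) :+ con (+ 1)))) :* ε) refl B C ε ⟩
          K * ε ∎
        where K = 1# + B * (C * 2#)

    slice-positive : ∃[ δ ] (0# < δ × (∀ z → δ ≤ ‖ 1# ∷ᵛ z ‖))
    slice-positive with em {∃[ δ ] (0# < δ × (∀ z → δ ≤ ‖ 1# ∷ᵛ z ‖))}
    ... | yes δ = δ
    ... | no ∄δ = contradiction
      (sym (definite _ (antisym ‖t‖≤0 (nonNegative _)) zero)) 0≉1
      where
      approach : ∀ ε → 0# < ε → ∃[ z ] ‖ 1# ∷ᵛ z ‖ < ε
      approach ε 0<ε with em {∃[ z ] ‖ 1# ∷ᵛ z ‖ < ε}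
      ... | yes z = z
      ... | no ∄z = contradiction (ε , 0<ε , λ z → ≮⇒≥ λ ‖z‖<ε → ∄z (z , ‖z‖<ε)) ∄δ

      ‖t‖≤0 = ‖limit‖≤0 approach (proj₁ ∘ coordinate-limit approach) (proj₂ ∘ coordinate-limit approach)

  -- Dividing by a nonzero first coordinate moves `x` into the slice, and homogeneity moves the
  -- bound back.
  ∣head∣*δ≤‖‖ : ∀ {s} {‖_‖ : Vector ℝ (suc s) → ℝ} → IsNorm ‖_‖ →
                ∀ {δ} → (∀ z → δ ≤ ‖ 1# ∷ᵛ z ‖) → ∀ x → δ * ∣ x zero ∣ ≤ ‖ x ‖
  ∣head∣*δ≤‖‖ {‖_‖ = ‖_‖} isNorm {δ} δ≤ x with em {x zero ≈ 0#}
  ... | yes x₀≈0 = begin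
    δ * ∣ x zero ∣                ≈⟨ *-congˡ (antisym (≤-trans (∣∣-cong-≤ x₀≈0) (∣x∣≤x ≤-refl)) (0≤∣x∣ _)) ⟩
    δ * 0#                        ≈⟨ zeroʳ δ ⟩
    0#                            ≤⟨ IsNorm.nonNegative isNorm x ⟩
    ‖ x ‖                         ∎
  ... | no x₀≉0 = begin
    δ * ∣ x₀ ∣                    ≤⟨ *-monoʳ-≤ (0≤∣x∣ x₀) (δ≤ z) ⟩
    ‖ 1# ∷ᵛ z ‖ * ∣ x₀ ∣          ≈⟨ *-comm _ _ ⟩
    ∣ x₀ ∣ * ‖ 1# ∷ᵛ z ‖          ≈⟨ homogeneous x₀ (1# ∷ᵛ z) ⟨
    ‖ (λ i → x₀ * (1# ∷ᵛ z) i) ‖  ≈⟨ ‖‖-cong (∷ᵛ-≋ (*-identityʳ x₀) λ i →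
                                       trans (sym (*-assoc _ _ _))
                                         (trans (*-congʳ (⁻¹-inverseʳ x₀≉0)) (*-identityˡ _))) ⟩
    ‖ x ‖                         ∎
    where
    open IsNorm isNorm
    x₀ = x zero
    z  = λ i → x₀ ⁻¹ * x (suc i)

  -- The first coordinate is controlled by the distance `δ` of the slice from the origin.
  -- Subtracting `x zero` times `e₀` then lands in the hyperplane, where the induction hypothesis
  -- controls the others. The sum of the two constants `δ ⁻¹` and `D` serves all coordinates.
  coordinates-bounded : ∀ {s} {‖_‖ : Vector ℝ s → ℝ} → IsNorm ‖_‖ →
                        ∃[ C ] (0# < C × (∀ x i → ∣ x i ∣ ≤ C * ‖ x ‖))
  coordinates-bounded {zero}  isNorm = 1# , 0<1 , λ _ ()
  coordinates-bounded {suc s} {‖_‖} isNorm with coordinates-bounded (restrict-isNorm isNorm)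
  ... | C , 0<C , tail≤ with slice-positive isNorm C 0<C tail≤
  ...   | δ , 0<δ , δ≤ = δ ⁻¹ + D , +-pos 0<δ⁻¹ 0≤D , λ where
      x zero → begin
        ∣ x zero ∣           ≤⟨ head≤ x ⟩
        δ ⁻¹ * ‖ x ‖         ≤⟨ *-monoʳ-≤ (nonNegative x) (x≤x+y 0≤D) ⟩
        (δ ⁻¹ + D) * ‖ x ‖   ∎
      x (suc i) → begin
        ∣ x (suc i) ∣                              ≤⟨ tail≤ (tail x) i ⟩
        C * ‖ 0# ∷ᵛ tail x ‖                       ≤⟨ *-monoˡ-≤ (<⇒≤ 0<C) (‖tail‖≤ x) ⟩
        C * (‖ x ‖ + δ ⁻¹ * ‖ x ‖ * ‖ e₀ ‖)
          ≈⟨ solve 4 (λ C n d e → C :* (n :+ d :* n :* e) := C :* (con (+ 1) :+ d :* e) :* n) refl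
               C (‖ x ‖) (δ ⁻¹) (‖ e₀ ‖) ⟩
        D * ‖ x ‖                                  ≤⟨ *-monoʳ-≤ (nonNegative x) (y≤x+y (<⇒≤ 0<δ⁻¹)) ⟩
        (δ ⁻¹ + D) * ‖ x ‖                         ∎
    where
    open IsNorm isNorm
    0<δ⁻¹ = 0<x⇒0<x⁻¹ 0<δ
    D     = C * (1# + δ ⁻¹ * ‖ e₀ ‖)

    0≤D : 0# ≤ D
    0≤D = *-nonNeg (<⇒≤ 0<C) (+-nonNeg 0≤1 (*-nonNeg (<⇒≤ 0<δ⁻¹) (nonNegative e₀)))

    head≤ : ∀ x → ∣ x zero ∣ ≤ δ ⁻¹ * ‖ x ‖
    head≤ x = *-cancelˡ-≤ 0<δ
      (≤-trans (∣head∣*δ≤‖‖ isNorm δ≤ x) (≤-reflexive (sym (x*[x⁻¹*y]≈y 0<δ _))))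

    ‖tail‖≤ : ∀ x → ‖ 0# ∷ᵛ tail x ‖ ≤ ‖ x ‖ + δ ⁻¹ * ‖ x ‖ * ‖ e₀ ‖
    ‖tail‖≤ x = begin
      ‖ 0# ∷ᵛ tail x ‖
        ≈⟨ ‖‖-cong (∷ᵛ-≋ (solve 1 (λ x → con (+ 0) := x :+ (:- x) :* con (+ 1)) refl (x zero))
                         (λ i → solve 2 (λ x y → y := y :+ (:- x) :* con (+ 0)) refl (x zero) (x (suc i)))) ⟩
      ‖ (λ i → x i + - x zero * e₀ i) ‖            ≤⟨ triangle _ _ ⟩
      ‖ x ‖ + ‖ (λ i → - x zero * e₀ i) ‖          ≈⟨ +-congˡ (homogeneous (- x zero) e₀) ⟩
      ‖ x ‖ + ∣ - x zero ∣ * ‖ e₀ ‖                ≤⟨ +-monoʳ-≤ _ (*-monoʳ-≤ (nonNegative e₀)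
                                                      (≤-trans (∣-x∣≤∣x∣ _) (head≤ x))) ⟩
      ‖ x ‖ + δ ⁻¹ * ‖ x ‖ * ‖ e₀ ‖                ∎

-- Finiteness and nonzero elements of index sets.

Vec-finite : {A : Set} {P : Pred A 0ℓ} → Finite P → ∀ s →
             Finite (λ (v : Vec A s) → ∀ i → P (lookup v i))
Vec-finite (xs , P⊆xs) zero    = [] ∷ [] , λ { [] _ → here ≡.refl }
Vec-finite (xs , P⊆xs) (suc s) =
  let vs , all⊆vs = Vec-finite (xs , P⊆xs) s in
  List.cartesianProductWith _∷_ xs vs , λ where
    (x ∷ v) Pxv → ∈-cartesianProductWith⁺ _∷_ (P⊆xs x (Pxv zero)) (all⊆vs v (Pxv ∘ suc))

coords-finite : ∀ {s} (Λ : IndexSet s) m →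
                Finite (λ k → ∀ i → ℤ.∣ coords Λ k i ∣ ℕ.≤ m)
coords-finite (ℤ^ s) m = Vec-finite (_ , bounded) s
  where
  bounded : ∀ i → ℤ.∣ i ∣ ℕ.≤ m →
            i ∈ List.map +_ (List.upTo (suc m)) List.++ List.map -[1+_] (List.upTo m)
  bounded (+ n)    n≤m = ∈-++⁺ˡ (∈-map⁺ +_ (∈-upTo⁺ (ℕ.s≤s n≤m)))
  -- The absolute value of `-[1+ n ]` is `suc n`, so the negative range stops one step earlier than
  -- the nonnegative one.
  bounded -[1+ n ] n<m = ∈-++⁺ʳ _ (∈-map⁺ -[1+_] (∈-upTo⁺ n<m))
coords-finite (ℕ₀^ s) m = Vec-finite (List.upTo (suc m) , λ n n≤m → ∈-upTo⁺ (ℕ.s≤s n≤m)) s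
coords-finite (ℕ^ s) m = Vec-finite (_ , bounded) s
  where
  bounded : ∀ n → proj₁ n ℕ.≤ m → n ∈ List.map (λ n → suc n , _) (List.upTo m)
  bounded (zero , record { nonZero = () })
  bounded (suc n , _) n<m = ∈-map⁺ _ (∈-upTo⁺ n<m)
coords-finite (_⊗_ {s} {t} Λ Μ) m =
  let ks , finiteΛ = coords-finite Λ m
      ls , finiteΜ = coords-finite Μ m
  in List.cartesianProduct ks ls , λ (k , l) bounded → ∈-cartesianProduct⁺
    (finiteΛ k λ i → ≡.subst (λ z → ℤ.∣ z ∣ ℕ.≤ m)
      (lookup-++ˡ (coords Λ k) (coords Μ l) i) (bounded (i ↑ˡ t)))
    (finiteΜ l λ i → ≡.subst (λ z → ℤ.∣ z ∣ ℕ.≤ m)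
      (lookup-++ʳ (coords Λ k) (coords Μ l) i) (bounded (s ↑ʳ i)))

point : ∀ {s} (Λ : IndexSet s) → ⟦ Λ ⟧
point (ℤ^ s)  = Vec.replicate s 0ℤ
point (ℕ₀^ s) = Vec.replicate s 0
point (ℕ^ s)  = Vec.replicate s (1 , _)
point (Λ ⊗ Μ) = point Λ , point Μ

-- Stated for a prescribed coordinate because a factor of a product may have dimension 0: the factor
-- to be made nonzero is the one containing `i`, and `point` fills the other.
nonzeroAt : ∀ {s} (Λ : IndexSet s) i → ∃[ k ] coords Λ k i ≢ 0ℤ
nonzeroAt (ℤ^ s)  i = Vec.replicate s (+ 1) , λ k≡0 →
  contradiction (≡.trans (≡.sym (lookup-replicate i (+ 1))) k≡0) λ ()
nonzeroAt (ℕ₀^ s) i = Vec.replicate s 1 , λ k≡0 →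
  contradiction (≡.trans (≡.cong +_ (≡.sym (lookup-replicate i 1))) k≡0) λ ()
nonzeroAt (ℕ^ s)  i = Vec.replicate s (1 , _) , λ k≡0 →
  contradiction (≡.trans (≡.cong (+_ ∘ proj₁) (≡.sym (lookup-replicate i (1 , _)))) k≡0) λ ()
nonzeroAt (_⊗_ {s} Λ Μ) i with splitAt s i
... | inj₁ j = let k , k≢0 = nonzeroAt Λ j in (k , point Μ) , k≢0
... | inj₂ j = let l , l≢0 = nonzeroAt Μ j in (point Λ , l) , l≢0

nonzeroPoint : ∀ {s} .{{_ : NonZero s}} (Λ : IndexSet s) → Λ ∖𝟎
nonzeroPoint {suc s} Λ = let k , k≢0 = nonzeroAt Λ zero in k , λ k≡0 → k≢0 (k≡0 zero)

-- Finiteness of the superlevel sets of a weight.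

module Weights (em : ExcludedMiddle 0ℓ) (R : CompleteOrderedField) where
  open CompleteOrderedField R hiding (zero)
  open Analysis em R
  open OrderedField em R
  open Norms em R
  open ≤-Reasoning

  -- A value `ρ k ≥ ε` forces `‖ k ‖ ≤ K₀`, hence coordinates of size at most `C * K₀`, which lies
  -- below some natural number `m`.
  weight-finite : ∀ {s} (Λ : IndexSet s) {‖_‖ : Vector ℝ s → ℝ} → IsNorm ‖_‖ →
                  {ρ : ⟦ Λ ⟧ → ℝ} → IsWeight Λ ‖_‖ ρ →
                  ∀ ε → 0# < ε → Finite (λ k → ε ≤ ρ k)
  weight-finite Λ {‖_‖} isNorm {ρ} isWeight ε 0<ε =
    let C , 0<C , coordinate≤ = coordinates-bounded isNorm
        K₀ , _ , small        = IsWeight.vanishing isWeight ε 0<ε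
        m , CK₀<m             = archimedean (C * K₀)
        ks , finite           = coords-finite Λ m
    in ks , λ k ε≤ρk → finite k λ i → ℕ.≮⇒≥ λ m<∣kᵢ∣ → <⇒≱ CK₀<m (begin
      fromℕ m                                        ≤⟨ fromℕ-mono-≤ (ℕ.<⇒≤ m<∣kᵢ∣) ⟩
      fromℕ ℤ.∣ coords Λ k i ∣                       ≤⟨ fromℕ∣i∣≤∣fromℤ∣ (coords Λ k i) ⟩
      ∣ fromℤ (coords Λ k i) ∣                       ≤⟨ coordinate≤ _ i ⟩
      C * ‖ (λ j → fromℤ (coords Λ k j)) ‖           ≤⟨ *-monoˡ-≤ (<⇒≤ 0<C)
                                                          (≮⇒≥ λ K₀<‖k‖ → <⇒≱ (small k K₀<‖k‖) ε≤ρk) ⟩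
      C * K₀                                         ∎)

-- Properties holding for all large N.

-- Definitionally the body of `_⟶_` and of `_⟶ℂ_` at a fixed `ε`, so limits can be used and produced
-- without conversion.
Eventually : Pred ℕ 0ℓ → Set
Eventually P = ∃[ N₀ ] (∀ N → N₀ ℕ.≤ N → P N)

eventually-map : ∀ {P Q : Pred ℕ 0ℓ} → (∀ {N} → P N → Q N) → Eventually P → Eventually Q
eventually-map P⇒Q (N₀ , P) = N₀ , λ N N₀≤N → P⇒Q (P N N₀≤N)

eventually-∩ : ∀ {P Q : Pred ℕ 0ℓ} → Eventually P → Eventually Q → Eventually (λ N → P N × Q N)
eventually-∩ (M , P) (N , Q) = M ℕ.⊔ N , λ K M⊔N≤K →
  P K (ℕ.≤-trans (ℕ.m≤m⊔n M N) M⊔N≤K) , Q K (ℕ.≤-trans (ℕ.m≤n⊔m M N) M⊔N≤K)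

eventually-nonZero : Eventually NonZero
eventually-nonZero = 1 , λ { (suc _) _ → _ }

eventually-all : {A : Set} {P : A → Pred ℕ 0ℓ} → (∀ a → Eventually (P a)) →
                 ∀ xs → Eventually (λ N → ∀ a → a ∈ xs → P a N)
eventually-all P-eventually []       = 0 , λ _ _ _ ()
eventually-all P-eventually (x ∷ xs) =
  eventually-map (λ where
    (P-x , _)  _ (here ≡.refl) → P-x
    (_ , P-xs) a (there a∈xs)  → P-xs a a∈xs)
  (eventually-∩ (P-eventually x) (eventually-all P-eventually xs))

-- Averages along a sequence.

module Averages (em : ExcludedMiddle 0ℓ) (R : CompleteOrderedField) where
  open CompleteOrderedField R hiding (zero)
  open Analysis em R
  open OrderedField em R
  open Suprema em R
  open ≤-Reasoning
  open Algebra.Properties.Semiring.Mult semiring using (×-congʳ; ×-assoc-*)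
  open Algebra.Properties.Semiring.Sum semiring
    using (sum-cong-≋; sum-replicate; ∑-distrib-+; *-distribˡ-sum)

  ∣x∣≤∣x-0∣ : ∀ x → ∣ x ∣ ≤ ∣ x - 0# ∣
  ∣x∣≤∣x-0∣ x = ∣∣-cong-≤ (solve 1 (λ x → x := x :- con (+ 0)) refl x)

  ∣x-0∣≤∣x∣ : ∀ x → ∣ x - 0# ∣ ≤ ∣ x ∣
  ∣x-0∣≤∣x∣ x = ∣∣-cong-≤ (solve 1 (λ x → x :- con (+ 0) := x) refl x)

  ⟶0⇒∣∣< : ∀ {a} → a ⟶ 0# → ∀ {ε} → 0# < ε → Eventually (λ N → ∣ a N ∣ < ε)
  ⟶0⇒∣∣< a⟶0 0<ε = eventually-map (≤-<-trans (∣x∣≤∣x-0∣ _)) (a⟶0 _ 0<ε)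

  ∣∣<⇒⟶0 : ∀ {a} → (∀ {ε} → 0# < ε → Eventually (λ N → ∣ a N ∣ < ε)) → a ⟶ 0#
  ∣∣<⇒⟶0 small ε 0<ε = eventually-map (≤-<-trans (∣x-0∣≤∣x∣ _)) (small 0<ε)

  ⟶0-linear : ∀ c {a b d} → a ⟶ 0# → b ⟶ 0# → (∀ N → d N ≈ c * a N + b N) → d ⟶ 0#
  ⟶0-linear c {a} {b} {d} a⟶0 b⟶0 d≈ca+b = ∣∣<⇒⟶0 λ {ε} 0<ε →
    let 0<½ε = *-pos 0<½ 0<ε in
    eventually-map (λ {N} (∣a∣< , ∣b∣<) → begin-strict
      ∣ d N ∣                            ≤⟨ ∣∣-cong-≤ (d≈ca+b N) ⟩
      ∣ c * a N + b N ∣                  ≤⟨ ∣x+y∣≤∣x∣+∣y∣ _ _ ⟩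
      ∣ c * a N ∣ + ∣ b N ∣              ≤⟨ +-monoˡ-≤ _ (∣x*y∣≤∣x∣*∣y∣ c (a N)) ⟩
      ∣ c ∣ * ∣ a N ∣ + ∣ b N ∣          ≤⟨ +-monoˡ-≤ _ (*-monoʳ-≤ (0≤∣x∣ _) (y≤x+y 0≤1)) ⟩
      K * ∣ a N ∣ + ∣ b N ∣              <⟨ +-mono-< (*-monoˡ-< 0<K ∣a∣<) ∣b∣< ⟩
      K * (K ⁻¹ * (½ * ε)) + ½ * ε       ≈⟨ +-congʳ (x*[x⁻¹*y]≈y 0<K _) ⟩
      ½ * ε + ½ * ε                      ≈⟨ ½x+½x≈x ε ⟩
      ε                                  ∎)
      (eventually-∩ (⟶0⇒∣∣< a⟶0 (*-pos (0<x⇒0<x⁻¹ 0<K) 0<½ε)) (⟶0⇒∣∣< b⟶0 0<½ε))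
    where
    -- The summand `1#` keeps `K` invertible when `c` is 0.
    K = 1# + ∣ c ∣

    0<K : 0# < K
    0<K = +-pos 0<1 (0≤∣x∣ c)

  sum-mono-≤ : ∀ {n} {x y : Vector ℝ n} → (∀ i → x i ≤ y i) → sum x ≤ sum y
  sum-mono-≤ {zero}  x≤y = ≤-refl
  sum-mono-≤ {suc n} x≤y = +-mono-≤ (x≤y zero) (sum-mono-≤ (x≤y ∘ suc))

  module _ {s : ℕ} (ω : ℕ → Cube s) where

    -- Distributivity suffices, whatever the value of `fromℕ N ⁻¹`; hence the identity covers
    -- `N = 0` too.
    Sℝ-linear : ∀ c {f g h : Cube s → ℝ} → (∀ x → h x ≈ c * f x + g x) →
                ∀ N → Sℝ N h ω ≈ c * Sℝ N f ω + Sℝ N g ω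
    Sℝ-linear c {f} {g} {h} h≈cf+g N = begin-equality
      r * sum (h ∘ x)                              ≈⟨ *-congˡ (sum-cong-≋ (h≈cf+g ∘ x)) ⟩
      r * sum (λ i → c * f (x i) + g (x i))        ≈⟨ *-congˡ (∑-distrib-+ (λ i → c * f (x i)) (g ∘ x)) ⟩
      r * (sum (λ i → c * f (x i)) + sum (g ∘ x))  ≈⟨ *-congˡ (+-congʳ (*-distribˡ-sum c (f ∘ x))) ⟨
      r * (c * sum (f ∘ x) + sum (g ∘ x))
        ≈⟨ solve 4 (λ r c F G → r :* (c :* F :+ G) := c :* (r :* F) :+ r :* G) refl
             r c (sum (f ∘ x)) (sum (g ∘ x)) ⟩
      c * (r * sum (f ∘ x)) + r * sum (g ∘ x)      ∎
      where
      r = fromℕ N ⁻¹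
      x : Fin N → Cube s
      x = ω ∘ toℕ

    Sℝ-const : ∀ c N → .{{NonZero N}} → Sℝ N (λ _ → c) ω ≈ c
    Sℝ-const c N = begin-equality
      fromℕ N ⁻¹ * sum {N} (λ _ → c)  ≈⟨ *-congˡ (sum-replicate N) ⟩
      fromℕ N ⁻¹ * (N · c)            ≈⟨ *-congˡ (×-congʳ N (*-identityˡ c)) ⟨
      fromℕ N ⁻¹ * (N · (1# * c))     ≈⟨ *-congˡ (×-assoc-* N 1# c) ⟨
      fromℕ N ⁻¹ * (fromℕ N * c)      ≈⟨ x⁻¹*[x*y]≈y (0<fromℕ N) c ⟩
      c                               ∎

    Sℝ-mono-≤ : ∀ {f g : Cube s → ℝ} → (∀ x → f x ≤ g x) →
                ∀ N → .{{NonZero N}} → Sℝ N f ω ≤ Sℝ N g ω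
    Sℝ-mono-≤ f≤g N = *-monoˡ-≤ (<⇒≤ (0<x⇒0<x⁻¹ (0<fromℕ N))) (sum-mono-≤ {N} λ i → f≤g (ω (toℕ i)))

    ∣Sℝ∣≤1 : ∀ {f : Cube s → ℝ} → (∀ x → ∣ f x ∣ ≤ 1#) → ∀ N → .{{NonZero N}} → ∣ Sℝ N f ω ∣ ≤ 1#
    ∣Sℝ∣≤1 {f} ∣f∣≤1 N = ∣∣-lub
      (begin
        Sℝ N f ω              ≤⟨ Sℝ-mono-≤ (λ x → ≤-trans (x≤∣x∣ _) (∣f∣≤1 x)) N ⟩
        Sℝ N (λ _ → 1#) ω     ≈⟨ Sℝ-const 1# N ⟩
        1#                    ∎)
      (begin
        - Sℝ N f ω              ≤⟨ -‿anti-≤ (Sℝ-mono-≤ -1≤f N) ⟩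
        - Sℝ N (λ _ → - 1#) ω   ≈⟨ -‿cong (Sℝ-const (- 1#) N) ⟩
        - - 1#                  ≈⟨ solve 0 (:- :- con (+ 1) := con (+ 1)) refl ⟩
        1#                      ∎)
      where
      -1≤f : ∀ x → - 1# ≤ f x
      -1≤f x = begin
        - 1#       ≤⟨ -‿anti-≤ (≤-trans (-x≤∣x∣ _) (∣f∣≤1 x)) ⟩
        - - f x    ≈⟨ solve 1 (λ y → :- :- y := y) refl (f x) ⟩
        f x        ∎

    module _ (ud : UniformlyDistributed ω) where

      -- Uniform distribution speaks of centred indicators `𝟙 J x - volume J`. Centring the whole
      -- step function by its integral makes it a linear combination of these, one list entry at a
      -- time.
      step-⟶0 : ∀ φ → (λ N → Sℝ N (λ x → eval φ x - integralˢ φ) ω) ⟶ 0#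
      step-⟶0 [] = ⟶0-linear 0# 0⟶0 0⟶0 λ N → begin-equality
        Sℝ N (λ _ → 0# - 0#) ω
          -- `Sℝ-const` would leave out `N = 0`. Since the constant `z - z` is minus itself plus
          -- itself, linearity makes its average 0 for every `N`.
          ≈⟨ Sℝ-linear (- 1#) (λ _ → solve 1 (λ z → z :- z := (:- con (+ 1)) :* (z :- z) :+ (z :- z)) refl 0#) N ⟩
        - 1# * Sℝ N (λ _ → 0# - 0#) ω + Sℝ N (λ _ → 0# - 0#) ω
          ≈⟨ solve 1 (λ S → (:- con (+ 1)) :* S :+ S := con (+ 0) :* con (+ 0) :+ con (+ 0)) refl _ ⟩
        0# * 0# + 0# ∎
        where
        0⟶0 : (λ _ → 0#) ⟶ 0#
        0⟶0 = ∣∣<⇒⟶0 λ 0<ε → 0 , λ _ _ → ≤-<-trans (∣x∣≤x ≤-refl) 0<ε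
      step-⟶0 ((c , J) ∷ φ) = ⟶0-linear c (ud J) (step-⟶0 φ) (Sℝ-linear c λ x →
        solve 5 (λ c χ v e I → c :* χ :+ e :- (c :* v :+ I) := c :* (χ :- v) :+ (e :- I)) refl
          c (𝟙 J x) (volume J) (eval φ x) (integralˢ φ))

      step-average : ∀ φ {ε} → 0# < ε →
                     Eventually (λ N → NonZero N × ∣ Sℝ N (eval φ) ω - integralˢ φ ∣ < ε)
      step-average φ 0<ε = eventually-map (λ {N} (N≢0 , ∣S∣<ε) → N≢0 , (begin-strict
        ∣ Sℝ N (eval φ) ω - integralˢ φ ∣            ≤⟨ ∣∣-cong-≤ (centre N {{N≢0}}) ⟩
        ∣ Sℝ N (λ x → eval φ x - integralˢ φ) ω ∣    <⟨ ∣S∣<ε ⟩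
        _                                            ∎))
        (eventually-∩ eventually-nonZero (⟶0⇒∣∣< (step-⟶0 φ) 0<ε))
        where
        I = integralˢ φ

        centre : ∀ N → .{{NonZero N}} → Sℝ N (eval φ) ω - I ≈ Sℝ N (λ x → eval φ x - I) ω
        centre N = begin-equality
          Sℝ N (eval φ) ω - I
            ≈⟨ +-congʳ (Sℝ-linear 1# (λ x → solve 2 (λ e I → e := con (+ 1) :* (e :- I) :+ I) refl (eval φ x) I) N) ⟩
          1# * Sℝ N (λ x → eval φ x - I) ω + Sℝ N (λ _ → I) ω - I
            ≈⟨ +-congʳ (+-congˡ (Sℝ-const I N)) ⟩
          1# * Sℝ N (λ x → eval φ x - I) ω + I - I
            ≈⟨ solve 2 (λ S I → con (+ 1) :* S :+ I :- I := S) refl _ I ⟩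
          Sℝ N (λ x → eval φ x - I) ω ∎

      -- A step function `φ ≤ f` with integral above `v - ε` leaves the slack
      -- `integralˢ φ - (v - ε)`. This slack is the tolerance granted to the averages of `φ`, so
      -- that the two errors add up to exactly `ε`.
      lower-average : ∀ {f v} → HasIntegralℝ f v → ∀ {ε} → 0# < ε →
                      Eventually (λ N → v - Sℝ N f ω < ε)
      lower-average {f} {v} (isSup , _) {ε} 0<ε =
        let y , (φ , φ≤f , y≈I) , v-ε<y = IsSupremum-approx isSup (x-y<x {v} 0<ε)
            0<I-[v-ε] = +-cancelʳ-< (v - ε) (begin-strict
              0# + (v - ε)                         ≈⟨ +-identityˡ _ ⟩
              v - ε                                <⟨ v-ε<y ⟩
              y                                    ≈⟨ y≈I ⟩
              integralˢ φ                          ≈⟨ solve 2 (λ I w → I := I :- w :+ w) refl _ (v - ε) ⟩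
              integralˢ φ - (v - ε) + (v - ε)      ∎)
        in eventually-map (λ {N} (N≢0 , close) → begin-strict
          v - Sℝ N f ω
            ≤⟨ +-monoʳ-≤ v (-‿anti-≤ (Sℝ-mono-≤ φ≤f N {{N≢0}})) ⟩
          v - Sℝ N (eval φ) ω
            ≈⟨ solve 3 (λ v S I → v :- S := :- (S :- I) :+ (v :- I)) refl v _ (integralˢ φ) ⟩
          - (Sℝ N (eval φ) ω - integralˢ φ) + (v - integralˢ φ)
            <⟨ +-monoˡ-< _ (≤-<-trans (-x≤∣x∣ _) close) ⟩
          integralˢ φ - (v - ε) + (v - integralˢ φ)
            ≈⟨ solve 3 (λ v ε I → I :- (v :- ε) :+ (v :- I) := ε) refl v ε (integralˢ φ) ⟩
          ε ∎) (step-average φ 0<I-[v-ε])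

      upper-average : ∀ {f v} → HasIntegralℝ f v → ∀ {ε} → 0# < ε →
                      Eventually (λ N → Sℝ N f ω - v < ε)
      upper-average {f} {v} (_ , isInf) {ε} 0<ε =
        let y , (ψ , f≤ψ , y≈I) , y<v+ε = IsInfimum-approx isInf (x<x+y {v} 0<ε)
            0<[v+ε]-I = +-cancelʳ-< (integralˢ ψ) (begin-strict
              0# + integralˢ ψ                     ≈⟨ +-identityˡ _ ⟩
              integralˢ ψ                          ≈⟨ y≈I ⟨
              y                                    <⟨ y<v+ε ⟩
              v + ε                                ≈⟨ solve 2 (λ I w → w := w :- I :+ I) refl _ (v + ε) ⟩
              v + ε - integralˢ ψ + integralˢ ψ    ∎)
        in eventually-map (λ {N} (N≢0 , close) → begin-strict
          Sℝ N f ω - v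
            ≤⟨ +-monoˡ-≤ (- v) (Sℝ-mono-≤ f≤ψ N {{N≢0}}) ⟩
          Sℝ N (eval ψ) ω - v
            ≈⟨ solve 3 (λ v S I → S :- v := (S :- I) :+ (I :- v)) refl v _ (integralˢ ψ) ⟩
          (Sℝ N (eval ψ) ω - integralˢ ψ) + (integralˢ ψ - v)
            <⟨ +-monoˡ-< _ (≤-<-trans (x≤∣x∣ _) close) ⟩
          v + ε - integralˢ ψ + (integralˢ ψ - v)
            ≈⟨ solve 3 (λ v ε I → v :+ ε :- I :+ (I :- v) := ε) refl v ε (integralˢ ψ) ⟩
          ε ∎) (step-average ψ 0<[v+ε]-I)

      average⟶integral : ∀ {f v} → HasIntegralℝ f v → (λ N → Sℝ N f ω) ⟶ v
      average⟶integral {f} {v} integral ε 0<ε =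
        eventually-map (λ {N} (upper , lower) → ∣∣-lub-< upper (begin-strict
          - (Sℝ N f ω - v)  ≈⟨ solve 2 (λ S v → :- (S :- v) := v :- S) refl _ v ⟩
          v - Sℝ N f ω      <⟨ lower ⟩
          ε                 ∎))
        (eventually-∩ (upper-average integral 0<ε) (lower-average integral 0<ε))

  -- The complex modulus compared with real and imaginary parts.

  0≤x*x : ∀ x → 0# ≤ x * x
  0≤x*x x with total 0# x
  ... | inj₁ 0≤x = *-nonNeg 0≤x 0≤x
  ... | inj₂ x≤0 = begin
    0#         ≤⟨ *-nonNeg (x≤0⇒0≤-x x≤0) (x≤0⇒0≤-x x≤0) ⟩
    - x * - x  ≈⟨ solve 1 (λ x → :- x :* :- x := x :* x) refl x ⟩
    x * x      ∎

  -- The difference factors as `(∣ x ∣ - x) * (∣ x ∣ + x)`, with both factors nonnegative.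
  x*x≤∣x∣*∣x∣ : ∀ x → x * x ≤ ∣ x ∣ * ∣ x ∣
  x*x≤∣x∣*∣x∣ x = 0≤y-x⇒x≤y (begin
    0#                             ≤⟨ *-nonNeg (x≤y⇒0≤y-x (x≤∣x∣ x)) (x≤y⇒0≤y-x (-x≤∣x∣ x)) ⟩
    (∣ x ∣ - x) * (∣ x ∣ - - x)    ≈⟨ solve 2 (λ x y → (y :- x) :* (y :- :- x) := y :* y :- x :* x) refl x (∣ x ∣) ⟩
    ∣ x ∣ * ∣ x ∣ - x * x          ∎)

  module _ (a b : ℝ) where

    -- Serves twice: it bounds the set whose supremum is the square root, which excludes the default
    -- value of `sup`, and it estimates the modulus from above.
    square≤⇒≤∣∣+∣∣ : ∀ t → t * t ≤ a * a + b * b → t ≤ ∣ a ∣ + ∣ b ∣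
    square≤⇒≤∣∣+∣∣ t t²≤ = ≮⇒≥ λ s<t → <⇒≱ (begin-strict
      s * s   ≤⟨ *-monoˡ-≤ 0≤s (<⇒≤ s<t) ⟩
      s * t   ≈⟨ *-comm s t ⟩
      t * s   <⟨ *-monoˡ-< (≤-<-trans 0≤s s<t) s<t ⟩
      t * t   ∎) (begin
      t * t                              ≤⟨ t²≤ ⟩
      a * a + b * b                      ≤⟨ +-mono-≤ (x*x≤∣x∣*∣x∣ a) (x*x≤∣x∣*∣x∣ b) ⟩
      ∣ a ∣ * ∣ a ∣ + ∣ b ∣ * ∣ b ∣      ≤⟨ x≤x+y (*-nonNeg (<⇒≤ 0<2) (*-nonNeg (0≤∣x∣ a) (0≤∣x∣ b))) ⟩
      ∣ a ∣ * ∣ a ∣ + ∣ b ∣ * ∣ b ∣ + 2# * (∣ a ∣ * ∣ b ∣)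
        ≈⟨ solve 2 (λ a b → a :* a :+ b :* b :+ (con (+ 1) :+ con (+ 1)) :* (a :* b) := (a :+ b) :* (a :+ b))
             refl (∣ a ∣) (∣ b ∣) ⟩
      s * s                              ∎)
      where
      s = ∣ a ∣ + ∣ b ∣

      0≤s : 0# ≤ s
      0≤s = +-nonNeg (0≤∣x∣ a) (0≤∣x∣ b)

    ∣∣ℂ-isSupremum : IsSupremum (λ t → t * t ≤ a * a + b * b) ∣ a , b ∣ℂ
    ∣∣ℂ-isSupremum = sup-isSupremum _ (a , x≤x+y (0≤x*x b)) (_ , square≤⇒≤∣∣+∣∣)

    ∣re∣≤∣∣ℂ : ∣ a ∣ ≤ ∣ a , b ∣ℂ
    ∣re∣≤∣∣ℂ = ∣∣-lub
      (proj₁ ∣∣ℂ-isSupremum a (x≤x+y (0≤x*x b)))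
      (proj₁ ∣∣ℂ-isSupremum (- a) (≤-trans
        (≤-reflexive (solve 1 (λ x → :- x :* :- x := x :* x) refl a)) (x≤x+y (0≤x*x b))))

    ∣im∣≤∣∣ℂ : ∣ b ∣ ≤ ∣ a , b ∣ℂ
    ∣im∣≤∣∣ℂ = ∣∣-lub
      (proj₁ ∣∣ℂ-isSupremum b (y≤x+y (0≤x*x a)))
      (proj₁ ∣∣ℂ-isSupremum (- b) (≤-trans
        (≤-reflexive (solve 1 (λ x → :- x :* :- x := x :* x) refl b)) (y≤x+y (0≤x*x a))))

    ∣∣ℂ≤∣re∣+∣im∣ : ∣ a , b ∣ℂ ≤ ∣ a ∣ + ∣ b ∣
    ∣∣ℂ≤∣re∣+∣im∣ = proj₂ ∣∣ℂ-isSupremum _ square≤⇒≤∣∣+∣∣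

    0≤∣∣ℂ : 0# ≤ ∣ a , b ∣ℂ
    0≤∣∣ℂ = ≤-trans (0≤∣x∣ a) ∣re∣≤∣∣ℂ

-- Attainment and the criterion for uniform distribution.

module SpectralTest (em : ExcludedMiddle 0ℓ) (R : CompleteOrderedField) where
  open CompleteOrderedField R hiding (zero)
  open Analysis em R
  open OrderedField em R
  open Suprema em R
  open Weights em R
  open Averages em R
  open ≤-Reasoning

  module _ {s : ℕ} .{{_ : NonZero s}} (Λ : IndexSet s)
           (ξ : ⟦ Λ ⟧ → CubeFunction s) (isUDD : IsUDD Λ ξ)
           {‖_‖ : Vector ℝ s → ℝ} (isNorm : IsNorm ‖_‖)
           (ρ : ⟦ Λ ⟧ → ℝ) (isWeight : IsWeight Λ ‖_‖ ρ)
           (ω : ℕ → Cube s) where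
    open IsUDD isUDD
    open IsWeight isWeight

    reS imS ∣S∣ : ℕ → ⟦ Λ ⟧ → ℝ
    reS N k = Sℝ N (re ∘ Func.to (ξ k)) ω
    imS N k = Sℝ N (im ∘ Func.to (ξ k)) ω
    ∣S∣ N k = ∣ reS N k , imS N k ∣ℂ

    ∣S∣≤∣reS∣+∣imS∣ : ∀ N k → ∣S∣ N k ≤ ∣ reS N k ∣ + ∣ imS N k ∣
    ∣S∣≤∣reS∣+∣imS∣ N k = ∣∣ℂ≤∣re∣+∣im∣ _ _

    ∣S∣≤2 : ∀ N .{{_ : NonZero N}} k → ∣S∣ N k ≤ 2#
    ∣S∣≤2 N k = ≤-trans (∣S∣≤∣reS∣+∣imS∣ N k) (+-mono-≤
      (∣Sℝ∣≤1 ω (λ x → ≤-trans (∣re∣≤∣∣ℂ _ _) (bounded k x)) N)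
      (∣Sℝ∣≤1 ω (λ x → ≤-trans (∣im∣≤∣∣ℂ _ _) (bounded k x)) N))

    0≤ρ∣S∣ : ∀ N k → 0# ≤ ρ k * ∣S∣ N k
    0≤ρ∣S∣ N k = *-nonNeg (<⇒≤ (positive k)) (0≤∣∣ℂ _ _)

    ρ∣S∣≤2ρ : ∀ N .{{_ : NonZero N}} k → ρ k * ∣S∣ N k ≤ 2# * ρ k
    ρ∣S∣≤2ρ N k = ≤-trans (*-monoˡ-≤ (<⇒≤ (positive k)) (∣S∣≤2 N k)) (≤-reflexive (*-comm _ _))

    ρ-finite : ∀ ε → 0# < ε → Finite (λ k → ε ≤ ρ k)
    ρ-finite = weight-finite Λ isNorm isWeight

    ρ∣S∣-finite : ∀ N .{{_ : NonZero N}} ε → 0# < ε → Finite (λ k → ε ≤ ρ k * ∣S∣ N k)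
    ρ∣S∣-finite N ε 0<ε =
      -- Halving the threshold absorbs the factor 2 of `ρ∣S∣≤2ρ`.
      let ks , finite = ρ-finite (½ * ε) (*-pos 0<½ 0<ε) in
      ks , λ k ε≤ρS → finite k (*-cancelˡ-≤ 0<2 (begin
        2# * (½ * ε)        ≈⟨ 2*[½*x]≈x ε ⟩
        ε                   ≤⟨ ε≤ρS ⟩
        ρ k * ∣S∣ N k       ≤⟨ ρ∣S∣≤2ρ N k ⟩
        2# * ρ k            ∎))

    supremumAttained : ∀ N .{{_ : NonZero N}} → SupremumAttained (weightedAverage Λ ξ ρ ω N)
    supremumAttained N = vanishing⇒supremumAttained
      (λ k → ρ k * ∣S∣ N k) (0≤ρ∣S∣ N) (ρ∣S∣-finite N) (nonzeroPoint Λ)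

    ρ* : Λ ∖𝟎 → ℝ
    ρ* (k , _) = ρ k

    ρ*-attained : SupremumAttained ρ*
    ρ*-attained = vanishing⇒supremumAttained ρ (<⇒≤ ∘ positive) ρ-finite (nonzeroPoint Λ)

    -- Makes the normalising factor of the spectral test a genuine positive inverse.
    0<⨆ρ* : 0# < ⨆ ρ*
    0<⨆ρ* = <-≤-trans (positive _) (≤⨆ ρ*-attained (nonzeroPoint Λ))

    spectralTest⟶0⇒ud : spectralTest Λ ξ ρ ω ⟶ 0# → UniformlyDistributed ω
    spectralTest⟶0⇒ud σ⟶0 = determining ω λ (k , k≢0) ε 0<ε →
      -- Chosen so that `⨆ ρ* * δ` equals `ρ k * (½ * ε)`. The half is there because real and
      -- imaginary part are each bounded by the modulus and then added.
      let δ   = (⨆ ρ*) ⁻¹ * (ρ k * (½ * ε))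
          0<δ = *-pos (0<x⇒0<x⁻¹ 0<⨆ρ*) (*-pos (positive k) (*-pos 0<½ 0<ε))
      in eventually-map (λ {N} (N≢0 , ∣σ∣<δ) →
        let ∣S∣<½ε = *-cancelˡ-< (<⇒≤ (positive k)) (begin-strict
              ρ k * ∣S∣ N k                        ≤⟨ ≤⨆ (supremumAttained N {{N≢0}}) (k , k≢0) ⟩
              ⨆ (weightedAverage Λ ξ ρ ω N)        ≈⟨ x*[x⁻¹*y]≈y 0<⨆ρ* _ ⟨
              ⨆ ρ* * spectralTest Λ ξ ρ ω N        ≤⟨ *-monoˡ-≤ (<⇒≤ 0<⨆ρ*) (x≤∣x∣ _) ⟩
              ⨆ ρ* * ∣ spectralTest Λ ξ ρ ω N ∣    <⟨ *-monoˡ-< 0<⨆ρ* ∣σ∣<δ ⟩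
              ⨆ ρ* * δ                             ≈⟨ x*[x⁻¹*y]≈y 0<⨆ρ* _ ⟩
              ρ k * (½ * ε)                        ∎)
        in begin-strict
        ∣ S N (Func.to (ξ k)) ω -ℂ 0ℂ ∣ℂ           ≤⟨ ∣∣ℂ≤∣re∣+∣im∣ _ _ ⟩
        ∣ reS N k - 0# ∣ + ∣ imS N k - 0# ∣        ≤⟨ +-mono-≤ (∣x-0∣≤∣x∣ _) (∣x-0∣≤∣x∣ _) ⟩
        ∣ reS N k ∣ + ∣ imS N k ∣                  ≤⟨ +-mono-≤ (∣re∣≤∣∣ℂ _ _) (∣im∣≤∣∣ℂ _ _) ⟩
        ∣S∣ N k + ∣S∣ N k                          <⟨ +-mono-< ∣S∣<½ε ∣S∣<½ε ⟩
        ½ * ε + ½ * ε                              ≈⟨ ½x+½x≈x ε ⟩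
        ε                                          ∎)
      (eventually-∩ eventually-nonZero (⟶0⇒∣∣< σ⟶0 0<δ))

    module _ (ud : UniformlyDistributed ω) where

      ρ∣S∣⟶0 : ((k , _) : Λ ∖𝟎) → ∀ {ε} → 0# < ε → Eventually (λ N → ρ k * ∣S∣ N k < ε)
      ρ∣S∣⟶0 (k , k≢0) {ε} 0<ε =
        eventually-map (λ {N} (∣reS∣<η , ∣imS∣<η) → begin-strict
          ρ k * ∣S∣ N k                            ≤⟨ *-monoˡ-≤ (<⇒≤ (positive k)) (∣S∣≤∣reS∣+∣imS∣ N k) ⟩
          ρ k * (∣ reS N k ∣ + ∣ imS N k ∣)        <⟨ *-monoˡ-< (positive k) (+-mono-< ∣reS∣<η ∣imS∣<η) ⟩
          ρ k * (½ * (ρ k ⁻¹ * ε) + ½ * (ρ k ⁻¹ * ε))  ≈⟨ *-congˡ (½x+½x≈x _) ⟩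
          ρ k * (ρ k ⁻¹ * ε)                       ≈⟨ x*[x⁻¹*y]≈y (positive k) ε ⟩
          ε                                        ∎)
        (eventually-∩
          (⟶0⇒∣∣< (average⟶integral ω ud (proj₁ (meanZero (k , k≢0)))) 0<η)
          (⟶0⇒∣∣< (average⟶integral ω ud (proj₂ (meanZero (k , k≢0)))) 0<η))
        where
        0<η = *-pos 0<½ (*-pos (0<x⇒0<x⁻¹ (positive k)) 0<ε)

      -- Uniformly in k: the tail of ρ bounds all but finitely many of the averages for every N.
      weightedAverage-uniform : ∀ {ε} → 0# < ε →
        Eventually (λ N → ∀ i → weightedAverage Λ ξ ρ ω N i < ε)
      weightedAverage-uniform {ε} 0<ε =
        let ks , finite = ρ-finite (½ * ε) (*-pos 0<½ 0<ε) in
        eventually-map (λ {N} (N≢0 , small) (k , k≢0) → uniform N {{N≢0}} k k≢0 λ ½ε≤ρk →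
          small k (finite k ½ε≤ρk) k≢0)
        (eventually-∩ eventually-nonZero (eventually-all pointwise ks))
        where
        -- The list `ks` may contain the zero index, about which the mean-zero condition says
        -- nothing. Placing `k ≢ 0` inside the eventual property makes the claim vacuous there.
        pointwise : ∀ k → Eventually (λ N → ¬ (∀ i → coords Λ k i ≡ 0ℤ) → ρ k * ∣S∣ N k < ε)
        pointwise k with em {∀ i → coords Λ k i ≡ 0ℤ}
        ... | yes k≡0 = 0 , λ _ _ k≢0 → contradiction k≡0 k≢0
        ... | no k≢0  = eventually-map (λ small _ → small) (ρ∣S∣⟶0 (k , k≢0) 0<ε)

        uniform : ∀ N .{{_ : NonZero N}} k → ¬ (∀ i → coords Λ k i ≡ 0ℤ) →
                  (½ * ε ≤ ρ k → ρ k * ∣S∣ N k < ε) → ρ k * ∣S∣ N k < ε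
        uniform N k k≢0 small with em {½ * ε ≤ ρ k}
        ... | yes ½ε≤ρk = small ½ε≤ρk
        ... | no ½ε≰ρk  = begin-strict
          ρ k * ∣S∣ N k   ≤⟨ ρ∣S∣≤2ρ N k ⟩
          2# * ρ k        <⟨ *-monoˡ-< 0<2 (≰⇒> ½ε≰ρk) ⟩
          2# * (½ * ε)    ≈⟨ 2*[½*x]≈x ε ⟩
          ε               ∎

      ud⇒spectralTest⟶0 : spectralTest Λ ξ ρ ω ⟶ 0#
      ud⇒spectralTest⟶0 = ∣∣<⇒⟶0 λ {ε} 0<ε →
        eventually-map (λ {N} (N≢0 , small) →
          -- Because the supremum is attained at `j`, the strict bound on the individual terms
          -- passes to it unchanged.
          let isSup , j@(k , _) , ⨆≈ρS = supremumAttained N {{N≢0}}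
              M⁻¹ = (⨆ ρ*) ⁻¹
              0<M⁻¹ = 0<x⇒0<x⁻¹ 0<⨆ρ*
          in begin-strict
          ∣ spectralTest Λ ξ ρ ω N ∣             ≤⟨ ∣∣-cong-≤ (*-congˡ ⨆≈ρS) ⟩
          ∣ M⁻¹ * (ρ k * ∣S∣ N k) ∣              ≤⟨ ∣x∣≤x (*-nonNeg (<⇒≤ 0<M⁻¹) (0≤ρ∣S∣ N k)) ⟩
          M⁻¹ * (ρ k * ∣S∣ N k)                  <⟨ *-monoˡ-< 0<M⁻¹ (small j) ⟩
          M⁻¹ * (⨆ ρ* * ε)                       ≈⟨ x⁻¹*[x*y]≈y 0<⨆ρ* ε ⟩
          ε                                      ∎)
        (eventually-∩ eventually-nonZero (weightedAverage-uniform (*-pos 0<⨆ρ* 0<ε)))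

theorem4p6 :
  (em : ExcludedMiddle 0ℓ) (R : CompleteOrderedField) →
  let open CompleteOrderedField R
      open Analysis em R
  in
  (s : ℕ) .{{_ : NonZero s}} (Λ : IndexSet s)
  (ξ : ⟦ Λ ⟧ → CubeFunction s) → IsUDD Λ ξ →
  (‖_‖ : Vector ℝ s → ℝ) → IsNorm ‖_‖ →
  (ρ : ⟦ Λ ⟧ → ℝ) → IsWeight Λ ‖_‖ ρ →
  (ω : ℕ → Cube s) →
  ((N : ℕ) .{{_ : NonZero N}} → SupremumAttained (weightedAverage Λ ξ ρ ω N))
  × (UniformlyDistributed ω ⇔ (spectralTest Λ ξ ρ ω ⟶ 0#))
theorem4p6 em R s Λ ξ isUDD ‖_‖ isNorm ρ isWeight ω =
    supremumAttained Λ ξ isUDD isNorm ρ isWeight ω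
  , mk⇔ (ud⇒spectralTest⟶0 Λ ξ isUDD isNorm ρ isWeight ω)
        (spectralTest⟶0⇒ud Λ ξ isUDD isNorm ρ isWeight ω)
  where open SpectralTest em R
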